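{- Let $R$ be a finite Frobenius ring with generating character $\chi$, let $V=R^n$, and let $G$ be a finite permutation group acting on the coordinates of $V$. Let $H$ be a subgroup of $G$ such that $|H|$ has an inverse in $R$, let $t$ be the number of orbits of $H$ on the coordinates, and let $T\subseteq E:=\{1,\dots,t\}$. If $C$ is a left $G$-code of length $n$ over $R$, then $$\mathrm{CJ}^{H}_{((C^{\perp})\theta_H)M_H,\,T}\bigl(\{x_a,y_a\}_{a\in R}\bigr) = \frac{1}{|C\theta_H|}\,\mathrm{CJ}^{H}_{C\theta_H,T}\Bigl(\Bigl\{\sum_{b\in R}\chi(ab)x_b\Bigr\}_{a\in R},\Bigl\{\sum_{b\in R}\chi(ab)y_b\Bigr\}_{a\in R}\Bigr),$$ where $M_H$ is the $H$-orbit length matrix.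
   Context: A finite (associative, unital) ring $R$ is Frobenius if $R/\mathrm{Rad}(R)\cong \mathrm{Soc}(R_R)$ as right $R$-modules and $R/\mathrm{Rad}(R)\cong\mathrm{Soc}({}_RR)$ as left $R$-modules. $R$ need not be commutative. Let $\widehat R$ be the group of homomorphisms from the additive group of $R$ to $\mathbb{C}^{*}$. A generating character of $R$ is a $\chi\in\widehat R$ that is right generating ($r\mapsto\chi^r$, $\chi^r(x)=\chi(rx)$, is an isomorphism of right $R$-modules $R\to\widehat R$) or left generating ($r\mapsto{}^r\chi$, ${}^r\chi(x)=\chi(xr)$, is an isomorphism of left $R$-modules $R\to\widehat R$); a finite ring is Frobenius if and only if it admits one. On $V=R^n$ put $(u,v):=u_1v_1+\cdots+u_nv_n$. A permutation group $G$ on $\{1,\dots,n\}$ acts on $V$ on the right by $(vg)_i = v_{ig^{ -1}}$. A left $G$-code is a left $R$-submodule $C$ of $V$ with $Cg\subseteq C$ for all $g\in G$; its right dual is $C^{\perp}:=\{u\in V:(v,u)=0\text{ for all }v\in C\}$. "$|H|$ has an inverse in $R$" means $|H|\cdot 1_R$ is a unit. Define $v\theta_H:=\frac1{|H|}\sum_{h\in H}vh$ for $v\in V$ and $X\theta_H:=\{v\theta_H:v\in X\}$. Let $H_V(\alpha_1),\dots,H_V(\alpha_t)$ be the orbits of $H$ on $\{1,\dots,n\}$, $m_i$ the cardinality of $H_V(\alpha_i)$, and $\overline{H_V(\alpha_i)}\in V$ the vector with entry $1$ at the positions in $H_V(\alpha_i)$ and $0$ elsewhere. Every $u\in V\theta_H$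 is uniquely $u=\sum_{i=1}^t u_i\overline{H_V(\alpha_i)}$ with $u_i\in R$. The $H$-orbit length matrix is $M_H:=\mathrm{diag}(\ell_1,\dots,\ell_n)$ with $\ell_j=m_i$ if $j\in H_V(\alpha_i)$; $YM_H:=\{yM_H:y\in Y\}$ for $Y\subseteq V$. For a left or right $R$-submodule $D\subseteq V\theta_H$ and $T\subseteq E=\{1,\dots,t\}$, the complete $H$-Jacobi polynomial is $\mathrm{CJ}^H_{D,T}(\{x_a,y_a\}_{a\in R}):=\sum_{u\in D}\prod_{a\in R}x_a^{n^H_{a,T}(u)}\,y_a^{n^H_{a,E\setminus T}(u)}$, where $n^H_{a,X}(u)$ is the number of $i\in X$ with $u_i=a$. -}

module Defs where

open import Level using (0ℓ; suc)
open import Algebra.Bundles using (Ring; CommutativeRing; AbelianGroup)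
open import Algebra.Bundles.Raw using (RawRing; RawSemiring)
open import Algebra.Core using (Op₂)
open import Algebra.Definitions using (Invertible)
import Algebra.Definitions.RawMonoid as RawMonoidOps
import Algebra.Definitions.RawSemiring as RawSemiringOps
open import Algebra.Module.Bundles.Raw using (RawLeftModule; RawRightModule)
open import Algebra.Module.Morphism.Structures
  using (module LeftModuleMorphisms; module RightModuleMorphisms)
import Algebra.Morphism.Structures as MorphismStructures
import Algebra.Properties.AbelianGroup as AbelianGroupProperties
import Algebra.Properties.CommutativeSemigroup as CommutativeSemigroupProperties
import Algebra.Properties.Ring as RingProperties
open import Algebra.Structures using (IsRing; IsCommutativeRing)
open import Data.Fin.Base using (Fin; zero; _↑ˡ_; _↑ʳ_)
import Data.Fin.Properties as Fin
open import Data.Fin.Permutation as Perm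
  using (Permutation′; _⟨$⟩ʳ_; _⟨$⟩ˡ_; _∘ₚ_; flip)
open import Data.Fin.Subset using (Subset; ∁; ∣_∣)
open import Data.Fin.Subset.Properties using (_∈?_)
open import Data.Integer.Base using (+_)
open import Data.List.Base as List
  using (List; []; _∷_; [_]; _++_; foldr; map; filter; length; allFin; cartesianProductWith)
open import Data.List.Membership.Propositional using (_∈_; lose; find)
open import Data.List.Membership.Propositional.Properties
  using (∈-map⁺; ∈-allFin; ∈-filter⁺; ∈-cartesianProductWith⁺)
open import Data.List.Relation.Unary.All as All using ()
open import Data.List.Relation.Unary.Any as Any using (here)
open import Data.Nat.Base as ℕ using (ℕ; NonZero)
import Data.Nat.Properties as ℕ
open import Data.Product.Base using (Σ; ∃; _×_; _,_; proj₁; proj₂)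
open import Data.Rational.Base as ℚ using (ℚ; 0ℚ; 1ℚ; ½; Positive; positive)
import Data.Rational.Properties as ℚ
open import Data.Sum.Base using (_⊎_)
open import Data.Vec.Base as Vec using (Vec; lookup; tabulate; zipWith; replicate)
open import Data.Vec.Properties using (≡-dec)
open import Function.Bundles using (_↔_; Inverse)
open import Function.Properties.Inverse using (↔-sym; ↔⇒↣)
open import Relation.Binary.Definitions using (DecidableEquality)
open import Relation.Binary.PropositionalEquality
  using (_≡_; refl; sym; trans; cong; subst)
open import Relation.Nullary using (¬_; Dec; yes; no; does)
import Tactic.RingSolver.Core.AlmostCommutativeRing as ACR
import Tactic.RingSolver.NonReflective as NonReflective
open import Relation.Nullary.Decidable using (dec⇒maybe; map′; via-injection; _→-dec_; _×-dec_)
open import Relation.Unary using (Pred; Decidable; _⊆_)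

private
  module RingSolver = NonReflective
    (ACR.fromCommutativeRing ℚ.+-*-commutativeRing (λ q → dec⇒maybe (0ℚ ℚ.≟ q)))

-- Real numbers are Cauchy sequences of rationals; two are equal when their
-- difference tends to 0.
record ℝ : Set where
  no-eta-equality
  field
    seq    : ℕ → ℚ
    cauchy : ∀ ε → 0ℚ ℚ.< ε → ∃ λ N → ∀ m n → N ℕ.≤ m → N ℕ.≤ n →
             ℚ.∣ seq m ℚ.- seq n ∣ ℚ.< ε

open ℝ public

infix 4 _≈ʳ_

record _≈ʳ_ (x y : ℝ) : Set where
  constructor mk≈
  field
    null : ∀ ε → 0ℚ ℚ.< ε → ∃ λ N → ∀ n → N ℕ.≤ n →
           ℚ.∣ seq x n ℚ.- seq y n ∣ ℚ.< ε

open _≈ʳ_ public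

private
  half : ∀ {ε} → 0ℚ ℚ.< ε → 0ℚ ℚ.< ε ℚ.* ½
  half {ε} 0<ε = ℚ.positive⁻¹ (ε ℚ.* ½) {{ℚ.pos*pos⇒pos ε {{positive 0<ε}} ½}}

  halves : ∀ ε → ε ℚ.* ½ ℚ.+ ε ℚ.* ½ ≡ ε
  halves ε = trans (sym (ℚ.*-distribˡ-+ ε ½ ½)) (ℚ.*-identityʳ ε)

  split-< : ∀ {ε} a b c → c ≡ a ℚ.+ b → ℚ.∣ a ∣ ℚ.< ε ℚ.* ½ → ℚ.∣ b ∣ ℚ.< ε ℚ.* ½ →
            ℚ.∣ c ∣ ℚ.< ε
  split-< {ε} a b _ refl a< b< = ℚ.≤-<-trans (ℚ.∣p+q∣≤∣p∣+∣q∣ a b)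
    (subst (ℚ.∣ a ∣ ℚ.+ ℚ.∣ b ∣ ℚ.<_) (halves ε) (ℚ.+-mono-< a< b<))

  ∣-∣-swap : ∀ a b → ℚ.∣ a ℚ.- b ∣ ≡ ℚ.∣ b ℚ.- a ∣
  ∣-∣-swap a b = trans (cong ℚ.∣_∣ (solve 2 (λ a b → a ⊕ ⊝ b , ⊝ (b ⊕ ⊝ a)) refl a b))
                       (ℚ.∣-p∣≡∣p∣ (b ℚ.- a))
    where open RingSolver

  0≤∣_∣ : ∀ a → 0ℚ ℚ.≤ ℚ.∣ a ∣
  0≤∣ a ∣ = ℚ.nonNegative⁻¹ ℚ.∣ a ∣ {{ℚ.∣-∣-nonNeg a}}

  maxˡ : ∀ {m} a b → a ℕ.⊔ b ℕ.≤ m → a ℕ.≤ m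
  maxˡ a b = ℕ.≤-trans (ℕ.m≤m⊔n a b)

  maxʳ : ∀ {m} a b → a ℕ.⊔ b ℕ.≤ m → b ℕ.≤ m
  maxʳ a b = ℕ.≤-trans (ℕ.m≤n⊔m a b)

  bound : (x : ℝ) → ∃ λ B → 0ℚ ℚ.< B × ∃ λ N → ∀ n → N ℕ.≤ n → ℚ.∣ seq x n ∣ ℚ.< B
  bound x = B , 0<B , N , λ n N≤n → ℚ.≤-<-trans
      (subst (λ q → ℚ.∣ q ∣ ℚ.≤ ℚ.∣ seq x N ∣ ℚ.+ ℚ.∣ seq x n ℚ.- seq x N ∣) (lem (seq x N) (seq x n))
        (ℚ.∣p+q∣≤∣p∣+∣q∣ (seq x N) (seq x n ℚ.- seq x N)))
      (ℚ.+-monoʳ-< ℚ.∣ seq x N ∣ (proj₂ c n N N≤n ℕ.≤-refl))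
    where
    open RingSolver
    c = cauchy x 1ℚ (ℚ.positive⁻¹ 1ℚ)
    N = proj₁ c
    B = ℚ.∣ seq x N ∣ ℚ.+ 1ℚ
    0<B : 0ℚ ℚ.< B
    0<B = ℚ.+-mono-≤-< 0≤∣ seq x N ∣ (ℚ.positive⁻¹ 1ℚ)
    lem : ∀ a b → a ℚ.+ (b ℚ.- a) ≡ b
    lem = solve 2 (λ a b → a ⊕ (b ⊕ ⊝ a) , b) refl

  scale : ∀ {B ε} → 0ℚ ℚ.< B → 0ℚ ℚ.< ε → ∃ λ δ → 0ℚ ℚ.< δ × B ℚ.* δ ≡ ε
  scale {B} {ε} 0<B 0<ε = δ , ℚ.positive⁻¹ δ {{δ-pos}} , B*δ≡ε
    where
    instance
      B-pos : Positive B
      B-pos = positive 0<B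
      ε-pos : Positive ε
      ε-pos = positive 0<ε
      B-nz : ℚ.NonZero B
      B-nz = ℚ.pos⇒nonZero B
    δ = ℚ.1/ B ℚ.* ε
    δ-pos : Positive δ
    δ-pos = ℚ.pos*pos⇒pos (ℚ.1/ B) {{ℚ.1/pos⇒pos B}} ε
    B*δ≡ε : B ℚ.* δ ≡ ε
    B*δ≡ε = trans (sym (ℚ.*-assoc B (ℚ.1/ B) ε))
            (trans (cong (ℚ._* ε) (ℚ.*-inverseʳ B)) (ℚ.*-identityˡ ε))

  ∣*∣-< : ∀ {B δ η} a b → 0ℚ ℚ.< B → B ℚ.* δ ≡ η → ℚ.∣ a ∣ ℚ.< B → ℚ.∣ b ∣ ℚ.< δ →
          ℚ.∣ a ℚ.* b ∣ ℚ.< η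
  ∣*∣-< {B} {δ} a b 0<B refl a<B b<δ = subst (ℚ._< B ℚ.* δ) (sym (ℚ.∣p*q∣≡∣p∣*∣q∣ a b))
    (ℚ.≤-<-trans (ℚ.*-monoʳ-≤-nonNeg ℚ.∣ b ∣ {{ℚ.∣-∣-nonNeg b}} (ℚ.<⇒≤ a<B))
                 (ℚ.*-monoʳ-<-pos B {{positive 0<B}} b<δ))

  product-< : ∀ {A B δ δ′ ε} a b c d → 0ℚ ℚ.< A → 0ℚ ℚ.< B →
              A ℚ.* δ ≡ ε ℚ.* ½ → B ℚ.* δ′ ≡ ε ℚ.* ½ →
              ℚ.∣ a ∣ ℚ.< A → ℚ.∣ d ∣ ℚ.< B → ℚ.∣ b ℚ.- d ∣ ℚ.< δ → ℚ.∣ a ℚ.- c ∣ ℚ.< δ′ →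
              ℚ.∣ a ℚ.* b ℚ.- c ℚ.* d ∣ ℚ.< ε
  product-< a b c d 0<A 0<B eqA eqB a<A d<B b-d a-c =
    split-< (a ℚ.* (b ℚ.- d)) (d ℚ.* (a ℚ.- c)) _
      (solve 4 (λ a b c d → (a ⊗ b) ⊕ ⊝ (c ⊗ d) , (a ⊗ (b ⊕ ⊝ d)) ⊕ (d ⊗ (a ⊕ ⊝ c))) refl a b c d)
      (∣*∣-< a _ 0<A eqA a<A b-d) (∣*∣-< d _ 0<B eqB d<B a-c)
    where open RingSolver

  +-exchange : ∀ a b c d → (a ℚ.+ b) ℚ.- (c ℚ.+ d) ≡ (a ℚ.- c) ℚ.+ (b ℚ.- d)
  +-exchange = solve 4 (λ a b c d → (a ⊕ b) ⊕ ⊝ (c ⊕ d) , (a ⊕ ⊝ c) ⊕ (b ⊕ ⊝ d)) refl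
    where open RingSolver

  neg-exchange : ∀ a b → ℚ.∣ (ℚ.- a) ℚ.- (ℚ.- b) ∣ ≡ ℚ.∣ a ℚ.- b ∣
  neg-exchange a b = trans
    (cong ℚ.∣_∣ (solve 2 (λ a b → ⊝ a ⊕ ⊝ (⊝ b) , ⊝ (a ⊕ ⊝ b)) refl a b)) (ℚ.∣-p∣≡∣p∣ (a ℚ.- b))
    where open RingSolver

infixl 6 _+ʳ_
infixl 7 _*ʳ_
infix  8 -ʳ_

fromℚ : ℚ → ℝ
seq    (fromℚ q) _     = q
cauchy (fromℚ q) ε 0<ε = 0 , λ _ _ _ _ →
  subst (λ z → ℚ.∣ z ∣ ℚ.< ε) (sym (ℚ.+-inverseʳ q)) 0<ε

_+ʳ_ : ℝ → ℝ → ℝ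
seq    (x +ʳ y) n     = seq x n ℚ.+ seq y n
cauchy (x +ʳ y) ε 0<ε =
  let (M , p) = cauchy x _ (half 0<ε)
      (N , q) = cauchy y _ (half 0<ε)
  in M ℕ.⊔ N , λ m n m≥ n≥ →
     split-< _ _ _ (+-exchange (seq x m) (seq y m) (seq x n) (seq y n))
       (p m n (maxˡ M N m≥) (maxˡ M N n≥)) (q m n (maxʳ M N m≥) (maxʳ M N n≥))

-ʳ_ : ℝ → ℝ
seq    (-ʳ x) n     = ℚ.- seq x n
cauchy (-ʳ x) ε 0<ε =
  let (M , p) = cauchy x ε 0<ε
  in M , λ m n m≥ n≥ → subst (ℚ._< ε) (sym (neg-exchange (seq x m) (seq x n))) (p m n m≥ n≥)

_*ʳ_ : ℝ → ℝ → ℝ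
seq    (x *ʳ y) n     = seq x n ℚ.* seq y n
cauchy (x *ʳ y) ε 0<ε =
  let (A , 0<A , K , a) = bound x
      (B , 0<B , L , b) = bound y
      (_ , 0<δ , eqA)   = scale 0<A (half 0<ε)
      (_ , 0<δ′ , eqB)  = scale 0<B (half 0<ε)
      (M , p) = cauchy y _ 0<δ
      (N , q) = cauchy x _ 0<δ′
  in (K ℕ.⊔ L) ℕ.⊔ (M ℕ.⊔ N) , λ m n m≥ n≥ →
     product-< (seq x m) (seq y m) (seq x n) (seq y n) 0<A 0<B eqA eqB
       (a m (maxˡ K L (maxˡ _ (M ℕ.⊔ N) m≥))) (b n (maxʳ K L (maxˡ _ (M ℕ.⊔ N) n≥)))
       (p m n (maxˡ M N (maxʳ (K ℕ.⊔ L) _ m≥)) (maxˡ M N (maxʳ (K ℕ.⊔ L) _ n≥)))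
       (q m n (maxʳ M N (maxʳ (K ℕ.⊔ L) _ m≥)) (maxʳ M N (maxʳ (K ℕ.⊔ L) _ n≥)))

≈ʳ-pointwise : ∀ {x y} → (∀ n → seq x n ≡ seq y n) → x ≈ʳ y
≈ʳ-pointwise {x} {y} eq = mk≈ λ ε 0<ε → 0 , λ n _ →
  subst (λ z → ℚ.∣ z ∣ ℚ.< ε)
    (sym (trans (cong (ℚ._- seq y n) (eq n)) (ℚ.+-inverseʳ (seq y n)))) 0<ε

≈ʳ-refl : ∀ {x} → x ≈ʳ x
≈ʳ-refl = ≈ʳ-pointwise λ _ → refl

≈ʳ-sym : ∀ {x y} → x ≈ʳ y → y ≈ʳ x
≈ʳ-sym {x} {y} x≈y = mk≈ λ ε 0<ε → let (N , p) = null x≈y ε 0<ε in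
  N , λ n n≥ → subst (ℚ._< ε) (∣-∣-swap (seq x n) (seq y n)) (p n n≥)

≈ʳ-trans : ∀ {x y z} → x ≈ʳ y → y ≈ʳ z → x ≈ʳ z
≈ʳ-trans {x} {y} {z} x≈y y≈z = mk≈ λ ε 0<ε →
  let (M , p) = null x≈y _ (half 0<ε)
      (N , q) = null y≈z _ (half 0<ε)
  in M ℕ.⊔ N , λ n n≥ →
     split-< _ _ _ (solve 3 (λ a b c → a ⊕ ⊝ c , (a ⊕ ⊝ b) ⊕ (b ⊕ ⊝ c)) refl (seq x n) (seq y n) (seq z n))
       (p n (maxˡ M N n≥)) (q n (maxʳ M N n≥))
  where open RingSolver

+ʳ-cong : ∀ {x y u v} → x ≈ʳ y → u ≈ʳ v → x +ʳ u ≈ʳ y +ʳ v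
+ʳ-cong {x} {y} {u} {v} x≈y u≈v = mk≈ λ ε 0<ε →
  let (M , p) = null x≈y _ (half 0<ε)
      (N , q) = null u≈v _ (half 0<ε)
  in M ℕ.⊔ N , λ n n≥ →
     split-< _ _ _ (+-exchange (seq x n) (seq u n) (seq y n) (seq v n))
       (p n (maxˡ M N n≥)) (q n (maxʳ M N n≥))

-ʳ-cong : ∀ {x y} → x ≈ʳ y → -ʳ x ≈ʳ -ʳ y
-ʳ-cong {x} {y} x≈y = mk≈ λ ε 0<ε → let (N , p) = null x≈y ε 0<ε in
  N , λ n n≥ → subst (ℚ._< ε) (sym (neg-exchange (seq x n) (seq y n))) (p n n≥)

*ʳ-cong : ∀ {x y u v} → x ≈ʳ y → u ≈ʳ v → x *ʳ u ≈ʳ y *ʳ v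
*ʳ-cong {x} {y} {u} {v} x≈y u≈v = mk≈ λ ε 0<ε →
  let (A , 0<A , K , a) = bound x
      (B , 0<B , L , b) = bound v
      (_ , 0<δ , eqA)   = scale 0<A (half 0<ε)
      (_ , 0<δ′ , eqB)  = scale 0<B (half 0<ε)
      (M , p) = null u≈v _ 0<δ
      (N , q) = null x≈y _ 0<δ′
  in (K ℕ.⊔ L) ℕ.⊔ (M ℕ.⊔ N) , λ n n≥ →
     product-< (seq x n) (seq u n) (seq y n) (seq v n) 0<A 0<B eqA eqB
       (a n (maxˡ K L (maxˡ _ (M ℕ.⊔ N) n≥))) (b n (maxʳ K L (maxˡ _ (M ℕ.⊔ N) n≥)))
       (p n (maxˡ M N (maxʳ (K ℕ.⊔ L) _ n≥))) (q n (maxʳ M N (maxʳ (K ℕ.⊔ L) _ n≥)))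

record ℂ : Set where
  no-eta-equality
  field
    re im : ℝ

open ℂ public

infix 4 _≈ᶜ_

record _≈ᶜ_ (z w : ℂ) : Set where
  constructor _,ᶜ_
  field
    re≈ : re z ≈ʳ re w
    im≈ : im z ≈ʳ im w

open _≈ᶜ_ public

infixl 6 _+ᶜ_
infixl 7 _*ᶜ_
infix  8 -ᶜ_

ofℚ : ℚ → ℂ
re (ofℚ q) = fromℚ q
im (ofℚ q) = fromℚ 0ℚ

_+ᶜ_ _*ᶜ_ : ℂ → ℂ → ℂ
re (z +ᶜ w) = re z +ʳ re w
im (z +ᶜ w) = im z +ʳ im w
re (z *ᶜ w) = re z *ʳ re w +ʳ -ʳ (im z *ʳ im w)
im (z *ᶜ w) = re z *ʳ im w +ʳ im z *ʳ re w

-ᶜ_ : ℂ → ℂ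
re (-ᶜ z) = -ʳ re z
im (-ᶜ z) = -ʳ im z

private
  pointwise : ∀ {z w} → (∀ n → seq (re z) n ≡ seq (re w) n) → (∀ n → seq (im z) n ≡ seq (im w) n) →
              z ≈ᶜ w
  pointwise p q = ≈ʳ-pointwise p ,ᶜ ≈ʳ-pointwise q

  open RingSolver

  *-assoc-re : ∀ a b c d e f →
    (((a ℚ.* c) ℚ.- (b ℚ.* d)) ℚ.* e) ℚ.- (((a ℚ.* d) ℚ.+ (b ℚ.* c)) ℚ.* f) ≡
    (a ℚ.* ((c ℚ.* e) ℚ.- (d ℚ.* f))) ℚ.- (b ℚ.* ((c ℚ.* f) ℚ.+ (d ℚ.* e)))
  *-assoc-re = solve 6 (λ a b c d e f → (((a ⊗ c) ⊕ ⊝ (b ⊗ d)) ⊗ e) ⊕ ⊝ (((a ⊗ d) ⊕ (b ⊗ c)) ⊗ f) ,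
    ((a ⊗ ((c ⊗ e) ⊕ ⊝ (d ⊗ f))) ⊕ ⊝ (b ⊗ ((c ⊗ f) ⊕ (d ⊗ e))))) refl

  *-assoc-im : ∀ a b c d e f →
    (((a ℚ.* c) ℚ.- (b ℚ.* d)) ℚ.* f) ℚ.+ (((a ℚ.* d) ℚ.+ (b ℚ.* c)) ℚ.* e) ≡
    (a ℚ.* ((c ℚ.* f) ℚ.+ (d ℚ.* e))) ℚ.+ (b ℚ.* ((c ℚ.* e) ℚ.- (d ℚ.* f)))
  *-assoc-im = solve 6 (λ a b c d e f → (((a ⊗ c) ⊕ ⊝ (b ⊗ d)) ⊗ f) ⊕ (((a ⊗ d) ⊕ (b ⊗ c)) ⊗ e) ,
    ((a ⊗ ((c ⊗ f) ⊕ (d ⊗ e))) ⊕ (b ⊗ ((c ⊗ e) ⊕ ⊝ (d ⊗ f))))) refl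

  *-identityˡ-re : ∀ a b → (1ℚ ℚ.* a) ℚ.- (0ℚ ℚ.* b) ≡ a
  *-identityˡ-re = solve 2 (λ a b → ((Κ 1ℚ) ⊗ a) ⊕ ⊝ ((Κ 0ℚ) ⊗ b) ,
    (a)) refl

  *-identityˡ-im : ∀ a b → (1ℚ ℚ.* b) ℚ.+ (0ℚ ℚ.* a) ≡ b
  *-identityˡ-im = solve 2 (λ a b → ((Κ 1ℚ) ⊗ b) ⊕ ((Κ 0ℚ) ⊗ a) ,
    (b)) refl

  *-identityʳ-re : ∀ a b → (a ℚ.* 1ℚ) ℚ.- (b ℚ.* 0ℚ) ≡ a
  *-identityʳ-re = solve 2 (λ a b → (a ⊗ (Κ 1ℚ)) ⊕ ⊝ (b ⊗ (Κ 0ℚ)) ,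
    (a)) refl

  *-identityʳ-im : ∀ a b → (a ℚ.* 0ℚ) ℚ.+ (b ℚ.* 1ℚ) ≡ b
  *-identityʳ-im = solve 2 (λ a b → (a ⊗ (Κ 0ℚ)) ⊕ (b ⊗ (Κ 1ℚ)) ,
    (b)) refl

  distribˡ-re : ∀ a b c d e f →
    (a ℚ.* (c ℚ.+ e)) ℚ.- (b ℚ.* (d ℚ.+ f)) ≡
    ((a ℚ.* c) ℚ.- (b ℚ.* d)) ℚ.+ ((a ℚ.* e) ℚ.- (b ℚ.* f))
  distribˡ-re = solve 6 (λ a b c d e f → (a ⊗ (c ⊕ e)) ⊕ ⊝ (b ⊗ (d ⊕ f)) ,
    (((a ⊗ c) ⊕ ⊝ (b ⊗ d)) ⊕ ((a ⊗ e) ⊕ ⊝ (b ⊗ f)))) refl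

  distribˡ-im : ∀ a b c d e f →
    (a ℚ.* (d ℚ.+ f)) ℚ.+ (b ℚ.* (c ℚ.+ e)) ≡
    ((a ℚ.* d) ℚ.+ (b ℚ.* c)) ℚ.+ ((a ℚ.* f) ℚ.+ (b ℚ.* e))
  distribˡ-im = solve 6 (λ a b c d e f → (a ⊗ (d ⊕ f)) ⊕ (b ⊗ (c ⊕ e)) ,
    (((a ⊗ d) ⊕ (b ⊗ c)) ⊕ ((a ⊗ f) ⊕ (b ⊗ e)))) refl

  distribʳ-re : ∀ a b c d e f →
    ((c ℚ.+ e) ℚ.* a) ℚ.- ((d ℚ.+ f) ℚ.* b) ≡
    ((c ℚ.* a) ℚ.- (d ℚ.* b)) ℚ.+ ((e ℚ.* a) ℚ.- (f ℚ.* b))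
  distribʳ-re = solve 6 (λ a b c d e f → ((c ⊕ e) ⊗ a) ⊕ ⊝ ((d ⊕ f) ⊗ b) ,
    (((c ⊗ a) ⊕ ⊝ (d ⊗ b)) ⊕ ((e ⊗ a) ⊕ ⊝ (f ⊗ b)))) refl

  distribʳ-im : ∀ a b c d e f →
    ((c ℚ.+ e) ℚ.* b) ℚ.+ ((d ℚ.+ f) ℚ.* a) ≡
    ((c ℚ.* b) ℚ.+ (d ℚ.* a)) ℚ.+ ((e ℚ.* b) ℚ.+ (f ℚ.* a))
  distribʳ-im = solve 6 (λ a b c d e f → ((c ⊕ e) ⊗ b) ⊕ ((d ⊕ f) ⊗ a) ,
    (((c ⊗ b) ⊕ (d ⊗ a)) ⊕ ((e ⊗ b) ⊕ (f ⊗ a)))) refl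

  *-comm-re : ∀ a b c d → (a ℚ.* c) ℚ.- (b ℚ.* d) ≡ (c ℚ.* a) ℚ.- (d ℚ.* b)
  *-comm-re = solve 4 (λ a b c d → (a ⊗ c) ⊕ ⊝ (b ⊗ d) ,
    ((c ⊗ a) ⊕ ⊝ (d ⊗ b))) refl

  *-comm-im : ∀ a b c d → (a ℚ.* d) ℚ.+ (b ℚ.* c) ≡ (c ℚ.* b) ℚ.+ (d ℚ.* a)
  *-comm-im = solve 4 (λ a b c d → (a ⊗ d) ⊕ (b ⊗ c) ,
    ((c ⊗ b) ⊕ (d ⊗ a))) refl

ℂ-isCommutativeRing : IsCommutativeRing _≈ᶜ_ _+ᶜ_ _*ᶜ_ -ᶜ_ (ofℚ 0ℚ) (ofℚ 1ℚ)
ℂ-isCommutativeRing = record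
  { isRing = record
    { +-isAbelianGroup = record
      { isGroup = record
        { isMonoid = record
          { isSemigroup = record
            { isMagma = record
              { isEquivalence = record
                { refl  = ≈ʳ-refl ,ᶜ ≈ʳ-refl
                ; sym   = λ p → ≈ʳ-sym (re≈ p) ,ᶜ ≈ʳ-sym (im≈ p)
                ; trans = λ p q → ≈ʳ-trans (re≈ p) (re≈ q) ,ᶜ ≈ʳ-trans (im≈ p) (im≈ q)
                }
              ; ∙-cong = λ p q → +ʳ-cong (re≈ p) (re≈ q) ,ᶜ +ʳ-cong (im≈ p) (im≈ q)
              }
            ; assoc = λ x y z → pointwise
                (λ n → ℚ.+-assoc (ρ x n) (ρ y n) (ρ z n)) (λ n → ℚ.+-assoc (ι x n) (ι y n) (ι z n))
            }
          ; identity = (λ x → pointwise (λ n → ℚ.+-identityˡ (ρ x n)) (λ n → ℚ.+-identityˡ (ι x n)))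
                     , (λ x → pointwise (λ n → ℚ.+-identityʳ (ρ x n)) (λ n → ℚ.+-identityʳ (ι x n)))
          }
        ; inverse = (λ x → pointwise (λ n → ℚ.+-inverseˡ (ρ x n)) (λ n → ℚ.+-inverseˡ (ι x n)))
                  , (λ x → pointwise (λ n → ℚ.+-inverseʳ (ρ x n)) (λ n → ℚ.+-inverseʳ (ι x n)))
        ; ⁻¹-cong = λ p → -ʳ-cong (re≈ p) ,ᶜ -ʳ-cong (im≈ p)
        }
      ; comm = λ x y → pointwise (λ n → ℚ.+-comm (ρ x n) (ρ y n)) (λ n → ℚ.+-comm (ι x n) (ι y n))
      }
    ; *-cong = λ p q →
        +ʳ-cong (*ʳ-cong (re≈ p) (re≈ q)) (-ʳ-cong (*ʳ-cong (im≈ p) (im≈ q)))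
        ,ᶜ +ʳ-cong (*ʳ-cong (re≈ p) (im≈ q)) (*ʳ-cong (im≈ p) (re≈ q))
    ; *-assoc = λ x y z → pointwise
        (λ n → *-assoc-re (ρ x n) (ι x n) (ρ y n) (ι y n) (ρ z n) (ι z n))
        (λ n → *-assoc-im (ρ x n) (ι x n) (ρ y n) (ι y n) (ρ z n) (ι z n))
    ; *-identity =
        (λ x → pointwise (λ n → *-identityˡ-re (ρ x n) (ι x n)) (λ n → *-identityˡ-im (ρ x n) (ι x n)))
      , (λ x → pointwise (λ n → *-identityʳ-re (ρ x n) (ι x n)) (λ n → *-identityʳ-im (ρ x n) (ι x n)))
    ; distrib =
        (λ x y z → pointwise
          (λ n → distribˡ-re (ρ x n) (ι x n) (ρ y n) (ι y n) (ρ z n) (ι z n))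
          (λ n → distribˡ-im (ρ x n) (ι x n) (ρ y n) (ι y n) (ρ z n) (ι z n)))
      , (λ x y z → pointwise
          (λ n → distribʳ-re (ρ x n) (ι x n) (ρ y n) (ι y n) (ρ z n) (ι z n))
          (λ n → distribʳ-im (ρ x n) (ι x n) (ρ y n) (ι y n) (ρ z n) (ι z n)))
    }
  ; *-comm = λ x y → pointwise
      (λ n → *-comm-re (ρ x n) (ι x n) (ρ y n) (ι y n))
      (λ n → *-comm-im (ρ x n) (ι x n) (ρ y n) (ι y n))
  }
  where
  ρ ι : ℂ → ℕ → ℚ
  ρ z n = seq (re z) n
  ι z n = seq (im z) n

ℂ-commutativeRing : CommutativeRing 0ℓ 0ℓ
ℂ-commutativeRing = record { isCommutativeRing = ℂ-isCommutativeRing }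

private
  module ℂR = CommutativeRing ℂ-commutativeRing
  module ℂ* = CommutativeSemigroupProperties ℂR.*-commutativeSemigroup

-- The group ℂ* of nonzero complex numbers, taken as the units of ℂ
record ℂˣ : Set where
  no-eta-equality
  field
    val     : ℂ
    inv     : ℂ
    val*inv : val ℂR.* inv ≈ᶜ ℂR.1#

open ℂˣ public

infix 4 _≈ˣ_

record _≈ˣ_ (z w : ℂˣ) : Set where
  constructor mk≈ˣ
  field
    val≈ : val z ≈ᶜ val w

open _≈ˣ_ public

infixl 7 _∙ˣ_
infix  8 _⁻¹ˣ

1ˣ : ℂˣ
val     1ˣ = ℂR.1#
inv     1ˣ = ℂR.1#
val*inv 1ˣ = ℂR.*-identityˡ ℂR.1#

_∙ˣ_ : ℂˣ → ℂˣ → ℂˣ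
val     (z ∙ˣ w) = val z ℂR.* val w
inv     (z ∙ˣ w) = inv z ℂR.* inv w
val*inv (z ∙ˣ w) = ℂR.trans (ℂ*.interchange (val z) (val w) (inv z) (inv w))
  (ℂR.trans (ℂR.*-cong (val*inv z) (val*inv w)) (ℂR.*-identityˡ ℂR.1#))

_⁻¹ˣ : ℂˣ → ℂˣ
val     (z ⁻¹ˣ) = inv z
inv     (z ⁻¹ˣ) = val z
val*inv (z ⁻¹ˣ) = ℂR.trans (ℂR.*-comm (inv z) (val z)) (val*inv z)

ℂˣ-abelianGroup : AbelianGroup 0ℓ 0ℓ
ℂˣ-abelianGroup = record
  { Carrier = ℂˣ
  ; _≈_     = _≈ˣ_
  ; _∙_     = _∙ˣ_
  ; ε       = 1ˣ
  ; _⁻¹     = _⁻¹ˣ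
  ; isAbelianGroup = record
    { isGroup = record
      { isMonoid = record
        { isSemigroup = record
          { isMagma = record
            { isEquivalence = record
              { refl  = mk≈ˣ ℂR.refl
              ; sym   = λ p → mk≈ˣ (ℂR.sym (val≈ p))
              ; trans = λ p q → mk≈ˣ (ℂR.trans (val≈ p) (val≈ q))
              }
            ; ∙-cong = λ p q → mk≈ˣ (ℂR.*-cong (val≈ p) (val≈ q))
            }
          ; assoc = λ x y z → mk≈ˣ (ℂR.*-assoc (val x) (val y) (val z))
          }
        ; identity = (λ x → mk≈ˣ (ℂR.*-identityˡ (val x))) , (λ x → mk≈ˣ (ℂR.*-identityʳ (val x)))
        }
      ; inverse = (λ x → mk≈ˣ (inv*val x)) , (λ x → mk≈ˣ (val*inv x))
      ; ⁻¹-cong = λ {x} {y} x≈y → mk≈ˣ (ℂR.trans (ℂR.sym (ℂR.*-identityʳ (inv x)))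
          (ℂR.trans (ℂR.*-congˡ (ℂR.sym (val*inv y)))
          (ℂR.trans (ℂR.sym (ℂR.*-assoc (inv x) (val y) (inv y)))
          (ℂR.trans (ℂR.*-congʳ (ℂR.trans (ℂR.*-congˡ (ℂR.sym (val≈ x≈y))) (inv*val x)))
                    (ℂR.*-identityˡ (inv y))))))
      }
    ; comm = λ x y → mk≈ˣ (ℂR.*-comm (val x) (val y))
    }
  }
  where
  inv*val : ∀ z → inv z ℂR.* val z ≈ᶜ ℂR.1#
  inv*val z = val*inv (z ⁻¹ˣ)

-- An element of ℂ[X₁,…,Xₖ] is a finite list of terms (coefficient , exponents).
-- An exponent vector may occur more than once; two polynomials are equal when
-- all their coefficients are.
Polynomial : ℕ → Set
Polynomial k = List (ℂ × Vec ℕ k)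

coeff : ∀ {k} → Polynomial k → Vec ℕ k → ℂ
coeff []            e = ℂR.0#
coeff ((c , d) ∷ p) e with ≡-dec ℕ._≟_ d e
... | yes _ = c ℂR.+ coeff p e
... | no  _ = coeff p e

infix 4 _≈ₚ_

record _≈ₚ_ {k} (p q : Polynomial k) : Set where
  constructor mk≈ₚ
  field
    coeff-≈ : ∀ e → coeff p e ≈ᶜ coeff q e

const : ∀ {k} → ℂ → Polynomial k
const c = [ (c , replicate _ 0) ]

var : ∀ {k} → Fin k → Polynomial k
var {k} i = [ (ℂR.1# , Vec.updateAt (replicate k 0) i (λ _ → 1)) ]

polynomialRawRing : ℕ → RawRing 0ℓ 0ℓ
polynomialRawRing k = record
  { Carrier = Polynomial k
  ; _≈_     = _≈ₚ_
  ; _+_     = _++_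
  ; _*_     = cartesianProductWith λ (c , d) (c′ , d′) → c ℂR.* c′ , zipWith ℕ._+_ d d′
  ; -_      = map λ (c , d) → ℂR.- c , d
  ; 0#      = []
  ; 1#      = const ℂR.1#
  }

record FiniteRing : Set₁ where
  infixl 6 _+_
  infixl 7 _*_
  infix  8 -_
  field
    Carrier : Set
    _+_ _*_ : Carrier → Carrier → Carrier
    -_      : Carrier → Carrier
    0# 1#   : Carrier
    isRing  : IsRing _≡_ _+_ _*_ -_ 0# 1#
    card    : ℕ
    enum    : Fin card ↔ Carrier

  ring : Ring 0ℓ 0ℓ
  ring = record { isRing = isRing }

  open Ring ring public using (rawRing; +-rawGroup)

  _≟_ : DecidableEquality Carrier
  _≟_ = via-injection (↔⇒↣ (↔-sym enum)) Fin._≟_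

  element : Fin card → Carrier
  element = Inverse.to enum

  index : Carrier → Fin card
  index = Inverse.from enum

  allElements : List Carrier
  allElements = map element (allFin card)

  ∈-allElements : ∀ a → a ∈ allElements
  ∈-allElements a = subst (_∈ allElements) (Inverse.inverseˡ enum refl)
                          (∈-map⁺ element (∈-allFin (index a)))

module _ (R : FiniteRing) where
  open FiniteRing R
  open Ring ring using (zeroˡ; zeroʳ; distribˡ; distribʳ)
  open RingProperties ring using (-1*x≈-x; -‿distribʳ-*; -‿distribˡ-*)

  -- Left and right ideals are treated together: `act r x` is r * x for left
  -- ideals and x * r for right ideals.
  module _ (act : Op₂ Carrier) where

    record Ideal : Set₁ where
      field
        member     : Pred Carrier 0ℓ
        member?    : Decidable member
        0∈         : member 0#
        +-closed   : ∀ {x y} → member x → member y → member (x + y)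
        act-closed : ∀ r {x} → member x → member (act r x)

    open Ideal

    IsMaximal : Ideal → Set₁
    IsMaximal I = ¬ (∀ x → member I x)
                × (∀ (J : Ideal) → member I ⊆ member J → ¬ (∀ x → member J x) → member J ⊆ member I)

    IsMinimal : Ideal → Set₁
    IsMinimal I = ¬ (∀ {x} → member I x → x ≡ 0#)
                × (∀ (J : Ideal) → member J ⊆ member I → ¬ (∀ {x} → member J x → x ≡ 0#) →
                   member I ⊆ member J)

    -- The socle is the sum of the minimal ideals.
    data Soc : Pred Carrier (suc 0ℓ) where
      zero    : Soc 0#
      minimal : ∀ {x} (I : Ideal) → IsMinimal I → member I x → Soc x
      plus    : ∀ {x y} → Soc x → Soc y → Soc (x + y)

    Soc-act : (∀ r → act r 0# ≡ 0#) → (∀ r x y → act r (x + y) ≡ act r x + act r y) →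
              ∀ r {x} → Soc x → Soc (act r x)
    Soc-act act-0 act-+ r zero              = subst Soc (sym (act-0 r)) zero
    Soc-act act-0 act-+ r (minimal I m x∈I) = minimal I m (act-closed I r x∈I)
    Soc-act act-0 act-+ r (plus {x} {y} s t) =
      subst Soc (sym (act-+ r x y)) (plus (Soc-act act-0 act-+ r s) (Soc-act act-0 act-+ r t))

  leftAct rightAct : Op₂ Carrier
  leftAct  r x = r * x
  rightAct r x = x * r

  -- The Jacobson radical, as the intersection of the maximal left ideals
  Rad : Pred Carrier (suc 0ℓ)
  Rad x = ∀ (I : Ideal leftAct) → IsMaximal leftAct I → Ideal.member I x

  -- R / Rad R is R with x and y identified when x - y ∈ Rad R.
  leftQuotientRad : RawLeftModule Carrier 0ℓ (suc 0ℓ)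
  leftQuotientRad = record
    { Carrierᴹ = Carrier ; _≈ᴹ_ = λ x y → Rad (x + - y)
    ; _+ᴹ_ = _+_ ; _*ₗ_ = _*_ ; 0ᴹ = 0# ; -ᴹ_ = -_ }

  rightQuotientRad : RawRightModule Carrier 0ℓ (suc 0ℓ)
  rightQuotientRad = record
    { Carrierᴹ = Carrier ; _≈ᴹ_ = λ x y → Rad (x + - y)
    ; _+ᴹ_ = _+_ ; _*ᵣ_ = _*_ ; 0ᴹ = 0# ; -ᴹ_ = -_ }

  leftSoc : RawLeftModule Carrier (suc 0ℓ) 0ℓ
  leftSoc = record
    { Carrierᴹ = Σ Carrier (Soc leftAct)
    ; _≈ᴹ_ = λ x y → proj₁ x ≡ proj₁ y
    ; _+ᴹ_ = λ (x , s) (y , t) → x + y , plus s t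
    ; _*ₗ_ = λ r (x , s) → r * x , scale-closed r s
    ; 0ᴹ   = 0# , zero
    ; -ᴹ_  = λ (x , s) → - x , subst (Soc leftAct) (-1*x≈-x x) (scale-closed (- 1#) s)
    }
    where
    scale-closed : ∀ r {x} → Soc leftAct x → Soc leftAct (r * x)
    scale-closed = Soc-act leftAct zeroʳ distribˡ

  rightSoc : RawRightModule Carrier (suc 0ℓ) 0ℓ
  rightSoc = record
    { Carrierᴹ = Σ Carrier (Soc rightAct)
    ; _≈ᴹ_ = λ x y → proj₁ x ≡ proj₁ y
    ; _+ᴹ_ = λ (x , s) (y , t) → x + y , plus s t
    ; _*ᵣ_ = λ (x , s) r → x * r , scale-closed r s
    ; 0ᴹ   = 0# , zero
    ; -ᴹ_  = λ (x , s) → - x , subst (Soc rightAct) (x*-1≡-x x) (scale-closed (- 1#) s)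
    }
    where
    scale-closed : ∀ r {x} → Soc rightAct x → Soc rightAct (x * r)
    scale-closed = Soc-act rightAct zeroˡ distribʳ
    x*-1≡-x : ∀ x → x * (- 1#) ≡ - x
    x*-1≡-x x = trans (sym (-‿distribʳ-* x 1#)) (cong -_ (Ring.*-identityʳ ring x))

  IsFrobenius : Set₁
  IsFrobenius = ∃ (RightModuleMorphisms.IsRightModuleIsomorphism rightQuotientRad rightSoc)
              × ∃ (LeftModuleMorphisms.IsLeftModuleIsomorphism leftQuotientRad leftSoc)

  private
    module U  = AbelianGroup ℂˣ-abelianGroup
    module Uₚ = AbelianGroupProperties ℂˣ-abelianGroup
    module Uₛ = CommutativeSemigroupProperties U.commutativeSemigroup

  open MorphismStructures.GroupMorphisms +-rawGroup U.rawGroup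

  record Character : Set where
    field
      ⟦_⟧                 : Carrier → ℂˣ
      isGroupHomomorphism : IsGroupHomomorphism ⟦_⟧

    open IsGroupHomomorphism isGroupHomomorphism public using (homo; ε-homo; ⁻¹-homo)

    value : Carrier → ℂ
    value a = val ⟦ a ⟧

  open Character

  infix 4 _≈ᵏ_

  record _≈ᵏ_ (ψ φ : Character) : Set where
    constructor mk≈ᵏ
    field
      ⟦⟧≈ : ∀ x → ⟦ ψ ⟧ x ≈ˣ ⟦ φ ⟧ x

  private
    mkCharacter : (f : Carrier → ℂˣ) → (∀ x y → f (x + y) ≈ˣ f x U.∙ f y) →
                  f 0# ≈ˣ U.ε → (∀ x → f (- x) ≈ˣ f x U.⁻¹) → Character
    mkCharacter f f-+ f-0 f-neg = record
      { ⟦_⟧ = f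
      ; isGroupHomomorphism = record
        { isMonoidHomomorphism = record
          { isMagmaHomomorphism = record
            { isRelHomomorphism = record { cong = λ { refl → U.refl } }
            ; homo = f-+
            }
          ; ε-homo = f-0
          }
        ; ⁻¹-homo = f-neg
        }
      }

    reindex : ∀ ψ {x y} → x ≡ y → ⟦ ψ ⟧ x ≈ˣ ⟦ ψ ⟧ y
    reindex ψ refl = U.refl

  1ᵏ : Character
  1ᵏ = mkCharacter (λ _ → U.ε) (λ _ _ → U.sym (U.identityˡ U.ε)) U.refl (λ _ → U.sym Uₚ.ε⁻¹≈ε)

  infixl 6 _∙ᵏ_
  infix  8 _⁻¹ᵏ

  _∙ᵏ_ : Character → Character → Character
  ψ ∙ᵏ φ = mkCharacter (λ x → ⟦ ψ ⟧ x U.∙ ⟦ φ ⟧ x)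
    (λ x y → U.trans (U.∙-cong (homo ψ x y) (homo φ x y)) (Uₛ.interchange _ _ _ _))
    (U.trans (U.∙-cong (ε-homo ψ) (ε-homo φ)) (U.identityˡ U.ε))
    (λ x → U.trans (U.∙-cong (⁻¹-homo ψ x) (⁻¹-homo φ x)) (Uₚ.⁻¹-∙-comm _ _))

  _⁻¹ᵏ : Character → Character
  ψ ⁻¹ᵏ = mkCharacter (λ x → ⟦ ψ ⟧ x U.⁻¹)
    (λ x y → U.trans (U.⁻¹-cong (homo ψ x y)) (U.sym (Uₚ.⁻¹-∙-comm _ _)))
    (U.trans (U.⁻¹-cong (ε-homo ψ)) Uₚ.ε⁻¹≈ε)
    (λ x → U.⁻¹-cong (⁻¹-homo ψ x))

  _^ᵏ_ : Character → Carrier → Character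
  χ ^ᵏ r = mkCharacter (λ x → ⟦ χ ⟧ (r * x))
    (λ x y → U.trans (reindex χ (distribˡ r x y)) (homo χ _ _))
    (U.trans (reindex χ (zeroʳ r)) (ε-homo χ))
    (λ x → U.trans (reindex χ (sym (-‿distribʳ-* r x))) (⁻¹-homo χ _))

  _ᵏ^_ : Carrier → Character → Character
  r ᵏ^ χ = mkCharacter (λ x → ⟦ χ ⟧ (x * r))
    (λ x y → U.trans (reindex χ (distribʳ r x y)) (homo χ _ _))
    (U.trans (reindex χ (zeroˡ r)) (ε-homo χ))
    (λ x → U.trans (reindex χ (sym (-‿distribˡ-* x r))) (⁻¹-homo χ _))

  rightDual : RawRightModule Carrier 0ℓ 0ℓ
  rightDual = record
    { Carrierᴹ = Character ; _≈ᴹ_ = _≈ᵏ_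
    ; _+ᴹ_ = _∙ᵏ_ ; _*ᵣ_ = _^ᵏ_ ; 0ᴹ = 1ᵏ ; -ᴹ_ = _⁻¹ᵏ }

  leftDual : RawLeftModule Carrier 0ℓ 0ℓ
  leftDual = record
    { Carrierᴹ = Character ; _≈ᴹ_ = _≈ᵏ_
    ; _+ᴹ_ = _∙ᵏ_ ; _*ₗ_ = _ᵏ^_ ; 0ᴹ = 1ᵏ ; -ᴹ_ = _⁻¹ᵏ }

  rightRegular : RawRightModule Carrier 0ℓ 0ℓ
  rightRegular = record
    { Carrierᴹ = Carrier ; _≈ᴹ_ = _≡_
    ; _+ᴹ_ = _+_ ; _*ᵣ_ = _*_ ; 0ᴹ = 0# ; -ᴹ_ = -_ }

  leftRegular : RawLeftModule Carrier 0ℓ 0ℓ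
  leftRegular = record
    { Carrierᴹ = Carrier ; _≈ᴹ_ = _≡_
    ; _+ᴹ_ = _+_ ; _*ₗ_ = _*_ ; 0ᴹ = 0# ; -ᴹ_ = -_ }

  IsRightGenerating IsLeftGenerating IsGenerating : Pred Character 0ℓ
  IsRightGenerating χ = RightModuleMorphisms.IsRightModuleIsomorphism rightRegular rightDual (χ ^ᵏ_)
  IsLeftGenerating  χ = LeftModuleMorphisms.IsLeftModuleIsomorphism leftRegular leftDual (_ᵏ^ χ)
  IsGenerating      χ = IsRightGenerating χ ⊎ IsLeftGenerating χ

-- A group of permutations of Fin n, listed without repetition. Points are acted on
-- from the right: i g is perm g ⟨$⟩ʳ i, and g ∘ₚ h applies g first.
record PermutationGroup (n : ℕ) : Set where
  field
    order      : ℕ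
    perm       : Fin order → Permutation′ n
    distinct   : ∀ {g h} → perm g Perm.≈ perm h → g ≡ h
    id-closed  : ∃ λ e → perm e Perm.≈ Perm.id
    ∘-closed   : ∀ g h → ∃ λ k → perm k Perm.≈ perm g ∘ₚ perm h
    inv-closed : ∀ g → ∃ λ k → perm k Perm.≈ flip (perm g)

open PermutationGroup public

infix 4 _≤ᴳ_

_≤ᴳ_ : ∀ {n} → PermutationGroup n → PermutationGroup n → Set
H ≤ᴳ G = ∀ h → ∃ λ g → perm G g Perm.≈ perm H h

InOrbit : ∀ {n} → PermutationGroup n → Fin n → Fin n → Set
InOrbit H j k = ∃ λ h → perm H h ⟨$⟩ʳ j ≡ k

inOrbit? : ∀ {n} (H : PermutationGroup n) j k → Dec (InOrbit H j k)
inOrbit? H j k = Fin.any? λ h → perm H h ⟨$⟩ʳ j Fin.≟ k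

-- An arbitrary numbering 1,…,t of the orbits, through representatives α i
record Orbits {n} (H : PermutationGroup n) : Set where
  field
    t        : ℕ
    α        : Fin t → Fin n
    covering : ∀ j → ∃ λ i → InOrbit H (α i) j
    disjoint : ∀ {i i′} → InOrbit H (α i) (α i′) → i ≡ i′

  orbit : Fin t → Subset n
  orbit i = tabulate λ j → does (inOrbit? H (α i) j)

  m : Fin t → ℕ
  m i = ∣ orbit i ∣

  orbitOf : Fin n → Fin t
  orbitOf j = proj₁ (covering j)

  ℓ : Fin n → ℕ
  ℓ j = m (orbitOf j)

module Code (R : FiniteRing) where
  open FiniteRing R
  open RawSemiringOps (RawRing.rawSemiring rawRing)
    using (sum) renaming (_×_ to _×ᴿ_) public

  V : ℕ → Set
  V n = Vec Carrier n

  rawV : ∀ n → RawLeftModule Carrier 0ℓ 0ℓ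
  rawV n = record
    { Carrierᴹ = V n
    ; _≈ᴹ_ = _≡_
    ; _+ᴹ_ = zipWith _+_
    ; _*ₗ_ = λ r → Vec.map (r *_)
    ; 0ᴹ   = replicate n 0#
    ; -ᴹ_  = Vec.map -_
    }

  module V {n} = RawLeftModule (rawV n)

  sumⱽ : ∀ {n k} → (Fin k → V n) → V n
  sumⱽ = RawMonoidOps.sum V.+ᴹ-rawMonoid

  allV : ∀ n → List (V n)
  allV ℕ.zero    = [ Vec.[] ]
  allV (ℕ.suc n) = cartesianProductWith Vec._∷_ allElements (allV n)

  ∈-allV : ∀ {n} (v : V n) → v ∈ allV n
  ∈-allV Vec.[]      = here refl
  ∈-allV (a Vec.∷ v) = ∈-cartesianProductWith⁺ Vec._∷_ (∈-allElements a) (∈-allV v)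

  _≟ⱽ_ : ∀ {n} → DecidableEquality (V n)
  _≟ⱽ_ = ≡-dec _≟_

  ∃ⱽ? : ∀ {n} {P : Pred (V n) 0ℓ} → Decidable P → Dec (∃ P)
  ∃ⱽ? {n} P? = map′ (λ p → let (v , _ , Pv) = find p in v , Pv)
                    (λ (v , Pv) → lose (∈-allV v) Pv)
                    (Any.any? P? (allV n))

  ∀ⱽ? : ∀ {n} {P : Pred (V n) 0ℓ} → Decidable P → Dec (∀ v → P v)
  ∀ⱽ? {n} P? = map′ (λ p v → All.lookup p (∈-allV v))
                    (λ p → All.tabulate λ {v} _ → p v)
                    (All.all? P? (allV n))

  -- A subset of the finite set V, with its (classically automatic) decidability
  record SubsetV (n : ℕ) : Set₁ where
    field
      member  : Pred (V n) 0ℓ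
      member? : Decidable member

  open SubsetV public

  members : ∀ {n} → SubsetV n → List (V n)
  members X = filter (member? X) (allV _)

  size : ∀ {n} → SubsetV n → ℕ
  size X = length (members X)

  size-nonZero : ∀ {n} (X : SubsetV n) {v} → member X v → NonZero (size X)
  size-nonZero X {v} v∈X with members X | ∈-filter⁺ (member? X) (∈-allV v) v∈X
  ... | _ ∷ _ | _ = _

  image : ∀ {n} → (V n → V n) → SubsetV n → SubsetV n
  image f X = record
    { member  = λ u → ∃ λ v → member X v × f v ≡ u
    ; member? = λ u → ∃ⱽ? λ v → member? X v ×-dec (f v ≟ⱽ u)
    }

  ⟨_,_⟩ : ∀ {n} → V n → V n → Carrier
  ⟨ u , v ⟩ = sum λ i → lookup u i * lookup v i

  _⊥ʳ : ∀ {n} → SubsetV n → SubsetV n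
  C ⊥ʳ = record
    { member  = λ u → ∀ v → member C v → ⟨ v , u ⟩ ≡ 0#
    ; member? = λ u → ∀ⱽ? λ v → member? C v →-dec (⟨ v , u ⟩ ≟ 0#)
    }

  -- (v · g) i = v (i g⁻¹)
  infixl 7 _·_

  _·_ : ∀ {n} → V n → Permutation′ n → V n
  v · g = tabulate λ i → lookup v (g ⟨$⟩ˡ i)

  record IsLeftSubmodule {n} (C : SubsetV n) : Set where
    field
      0∈        : member C V.0ᴹ
      +-closed  : ∀ {u v} → member C u → member C v → member C (u V.+ᴹ v)
      *ₗ-closed : ∀ r {v} → member C v → member C (r V.*ₗ v)

  record LeftGCode {n} (G : PermutationGroup n) : Set₁ where
    field
      subset          : SubsetV n
      isLeftSubmodule : IsLeftSubmodule subset
      ·-closed        : ∀ g {v} → member subset v → member subset (v · perm G g)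

    open IsLeftSubmodule isLeftSubmodule public

  open LeftGCode public using (subset)

  OrderInvertible : ∀ {n} → PermutationGroup n → Set
  OrderInvertible H = Invertible _≡_ 1# _*_ (order H ×ᴿ 1#)

  θ : ∀ {n} (H : PermutationGroup n) → OrderInvertible H → V n → V n
  θ H (1/∣H∣ , _) v = 1/∣H∣ V.*ₗ sumⱽ λ h → v · perm H h

  _*ᴹ_ : ∀ {n} → V n → (Fin n → Fin n → Carrier) → V n
  v *ᴹ A = tabulate λ j → sum λ i → lookup v i * A i j

  diag : ∀ {n} → (Fin n → Carrier) → Fin n → Fin n → Carrier
  diag d i j with i Fin.≟ j
  ... | yes _ = d i
  ... | no  _ = 0#

  module _ {n} {H : PermutationGroup n} (O : Orbits H) where
    open Orbits O

    M : Fin n → Fin n → Carrier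
    M = diag λ j → ℓ j ×ᴿ 1#

    -- A vector of V θ is constant on each orbit, so its coefficient at the
    -- indicator vector of the i-th orbit is its entry at the representative α i.
    coordinate : V n → Fin t → Carrier
    coordinate u i = lookup u (α i)

    occurrences : Carrier → Subset t → V n → ℕ
    occurrences a X u = length (filter (λ i → i ∈? X ×-dec (coordinate u i ≟ a)) (allFin t))

    module _ (A : RawSemiring 0ℓ 0ℓ) where
      private
        module A = RawSemiring A
        open RawSemiringOps A using (product; _^_)

      -- The arguments x and y may be taken in any semiring, so that the same
      -- definition gives the polynomial and the result of substituting in it.
      CJ : SubsetV n → Subset t → (Carrier → A.Carrier) → (Carrier → A.Carrier) → A.Carrier
      CJ D T x y = foldr (λ u s → term u A.+ s) A.0# (members D)
        where
        term : V n → A.Carrier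
        term u = product λ i → let a = element i in
          (x a ^ occurrences a T u) A.* (y a ^ occurrences a (∁ T) u)

  -- x_a is the variable numbered index a, and y_a the one numbered card + index a.
  ℂ[x,y] : RawRing 0ℓ 0ℓ
  ℂ[x,y] = polynomialRawRing (card ℕ.+ card)

  X Y : Carrier → RawRing.Carrier ℂ[x,y]
  X a = var (index a ↑ˡ card)
  Y a = var (card ↑ʳ index a)

  transform : Character R → (Carrier → RawRing.Carrier ℂ[x,y]) → Carrier → RawRing.Carrier ℂ[x,y]
  transform χ z a = RawSemiringOps.sum (RawRing.rawSemiring ℂ[x,y])
    λ i → let b = element i in const (Character.value χ (a * b)) P.* z b
    where module P = RawRing ℂ[x,y]

  module _ {n} {G : PermutationGroup n} (C : LeftGCode G)
           (H : PermutationGroup n) (∣H∣-unit : OrderInvertible H) where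
    open LeftGCode C using (0∈)

    Cθ : SubsetV n
    Cθ = image (θ H ∣H∣-unit) (subset C)

    1/∣Cθ∣ : ℂ
    1/∣Cθ∣ = ofℚ (((+ 1) ℚ./ size Cθ) {{size-nonZero Cθ (_ , 0∈ , refl)}})

{-# OPTIONS --safe #-}
module Submission where

-- Let D ⊆ R^t collect the coordinates of the vectors of Cθ_H; it is a left
-- submodule. The claim is the MacWilliams identity for D, with the pair (x , y)
-- regarded as one family of variables z_i (z_i = x for i ∈ T, z_i = y otherwise),
-- once D^⊥ is recognised as the set of coordinates of ((C^⊥)θ_H)M_H; the latter
-- holds because θ_H is idempotent and self-adjoint for the inner product of V.
-- The MacWilliams identity comes from expanding the product over i of the sums
-- Σ_b χ(u_i b) z_i(b): the sum of χ(⟨u , w⟩) over u ∈ D is ∣D∣ if w ∈ D^⊥, and it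
-- vanishes otherwise, because χ is nontrivial on the left ideal { ⟨u , w⟩ : u ∈ D }.

open import Defs
open import Algebra.Bundles using (CommutativeMonoid; CommutativeRing; CommutativeSemiring; Ring; Semiring)
open import Algebra.Bundles.Raw using (RawRing; RawSemiring)
import Algebra.Definitions.RawSemiring as RawSemiringOps
open import Algebra.Module.Morphism.Structures
  using (module LeftModuleMorphisms; module RightModuleMorphisms)
open import Algebra.Morphism.Structures using (module SemiringMorphisms)
import Algebra.Properties.CommutativeMonoid.Sum as CommutativeMonoidSum
import Algebra.Properties.CommutativeSemigroup as CommutativeSemigroupProperties
import Algebra.Properties.Group as GroupProperties
import Algebra.Properties.Ring as RingProperties
import Algebra.Properties.Semiring.Mult as SemiringMult
import Algebra.Properties.Semiring.Sum as SemiringSum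
open import Algebra.Structures.Biased using (isCommutativeSemiringˡ)
open import Data.Empty using (⊥-elim)
open import Data.Fin.Base using (Fin; zero; suc)
open import Data.Fin.Permutation as Perm using (Permutation′; _⟨$⟩ʳ_; _⟨$⟩ˡ_; permutation)
import Data.Fin.Properties as Fin
open import Data.Fin.Subset using (Subset; ∁; ∣_∣)
open import Data.Fin.Subset.Properties using (_∈?_; x∈∁p⇒x∉p; x∉p⇒x∈∁p)
import Data.Integer.Base as ℤ
import Data.Integer.Properties as ℤ
open import Data.List.Base using (List; []; _∷_; _++_; foldr; map; filter; length; allFin; cartesianProductWith)
open import Data.List.Membership.Propositional using (_∈_)
open import Data.List.Membership.Propositional.Properties using (∈-map⁺; ∈-map⁻; ∈-filter⁺; ∈-filter⁻)
open import Data.List.Membership.Propositional.Properties.WithK using (unique∧set⇒bag)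
import Data.List.Properties as List
open import Data.List.Relation.Binary.BagAndSetEquality using (∼bag⇒↭)
open import Data.List.Relation.Binary.Permutation.Propositional using (_↭_; ↭⇒↭ₛ′)
import Data.List.Relation.Binary.Permutation.Propositional.Properties as ↭
import Data.List.Relation.Binary.Permutation.Setoid.Properties as ↭ₛ
open import Data.List.Relation.Unary.All as All using ([]; _∷_)
import Data.List.Relation.Unary.All.Properties as All
open import Data.List.Relation.Unary.Any using (here; there)
open import Data.List.Relation.Unary.Unique.Propositional using (Unique; []; _∷_)
import Data.List.Relation.Unary.Unique.Propositional.Properties as Unique
open import Data.Nat.Base as ℕ using (ℕ)
import Data.Nat.Properties as ℕ
open import Data.Product.Base using (_×_; _,_; ∃; proj₁; proj₂)
open import Data.Rational.Base as ℚ using (ℚ; 0ℚ; 1ℚ; ½)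
import Data.Rational.Properties as ℚ
open import Data.Rational.Solver using (module +-*-Solver)
open import Data.Rational.Unnormalised.Base as ℚᵘ using (mkℚᵘ; *≡*)
import Data.Rational.Unnormalised.Properties as ℚᵘ
open import Data.Sum.Base using (inj₁; inj₂)
open import Data.Vec.Base as Vec using (Vec; lookup; tabulate; zipWith; replicate)
open import Data.Vec.Properties as Vec using (≡-dec)
open import Function.Base using (_∘_)
open import Function.Bundles using (Injection; Inverse; mk⇔)
open import Function.Properties.Inverse using (↔⇒↣)
open import Level using (Level; 0ℓ)
open import Relation.Binary.Core using (Rel)
open import Relation.Binary.PropositionalEquality as ≡ using (_≡_; _≢_; module ≡-Reasoning)
import Relation.Binary.Reasoning.Setoid as SetoidReasoning
open import Relation.Binary.Structures using (IsEquivalence)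
open import Relation.Nullary using (¬_; Dec; yes; no; does)
open import Relation.Nullary.Decidable using (_×-dec_)
open import Relation.Nullary.Negation using (contradiction)
open import Relation.Unary using (Pred; Decidable)

open SemiringMorphisms using (IsSemiringHomomorphism)

-- Sums over lists

-- On V θ_H, collecting the positions by orbits turns the inner product of V into the sum of the m_i
-- u_i v_i, not of the u_i v_i. Multiplying the second vector by M_H absorbs the weights m_i. This
-- is why M_H stands in the identity: it turns orthogonality in V into orthogonality for the
-- standard form on R^t. The ring need not be commutative, but m_i and 1/∣H∣ come from integers, so
-- they are central and may be moved across the products.
--
-- The other obstacle is constructive. Equality in ℂ is not decidable, so one cannot search for a
-- vector of D on which the character is nontrivial. The vanishing of a character sum is instead
-- obtained by refuting its non-vanishing, which requires that equality with 0 in ℂ be stable under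
-- double negation and that ℂ have no zero divisors in a correspondingly weak sense.

module ListSum {c ℓ} (M : CommutativeMonoid c ℓ) where
  open CommutativeMonoid M
  open CommutativeMonoidSum M
  open SetoidReasoning setoid

  private variable
    a b d : Level
    A : Set a
    B : Set b
    C : Set d

  -- The fold has the same shape as the one in `CJ`, so that a Jacobi polynomial is a `foldMap` by
  -- definition and can be rewritten by `foldMap-cong`.
  foldMap : (A → Carrier) → List A → Carrier
  foldMap f = foldr (λ x s → f x ∙ s) ε

  -- The summands may be compared with the knowledge that `x` is listed: `characterSum-dual` can
  -- evaluate the character only at vectors of `D`.
  foldMap-cong : ∀ {f g : A → Carrier} xs → (∀ {x} → x ∈ xs → f x ≈ g x) →
                 foldMap f xs ≈ foldMap g xs
  foldMap-cong []       f≈g = refl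
  foldMap-cong (x ∷ xs) f≈g = ∙-cong (f≈g (here ≡.refl)) (foldMap-cong xs (f≈g ∘ there))

  foldMap-map : ∀ (f : B → Carrier) (g : A → B) xs → foldMap f (map g xs) ≡ foldMap (f ∘ g) xs
  foldMap-map f g []       = ≡.refl
  foldMap-map f g (x ∷ xs) = ≡.cong (f (g x) ∙_) (foldMap-map f g xs)

  foldMap-++ : ∀ (f : A → Carrier) xs ys → foldMap f (xs ++ ys) ≈ foldMap f xs ∙ foldMap f ys
  foldMap-++ f []       ys = sym (identityˡ _)
  foldMap-++ f (x ∷ xs) ys = trans (∙-congˡ (foldMap-++ f xs ys)) (sym (assoc _ _ _))

  foldMap-cartesianProductWith : ∀ (f : C → Carrier) (g : A → B → C) xs ys →
    foldMap f (cartesianProductWith g xs ys) ≈ foldMap (λ x → foldMap (f ∘ g x) ys) xs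
  foldMap-cartesianProductWith f g []       ys = refl
  foldMap-cartesianProductWith f g (x ∷ xs) ys = begin
    foldMap f (map (g x) ys ++ cartesianProductWith g xs ys)
      ≈⟨ foldMap-++ f (map (g x) ys) _ ⟩
    foldMap f (map (g x) ys) ∙ foldMap f (cartesianProductWith g xs ys)
      ≈⟨ ∙-cong (reflexive (foldMap-map f (g x) ys)) (foldMap-cartesianProductWith f g xs ys) ⟩
    foldMap (f ∘ g x) ys ∙ foldMap (λ x → foldMap (f ∘ g x) ys) xs
      ∎

  foldMap-ε : ∀ (xs : List A) → foldMap (λ _ → ε) xs ≈ ε
  foldMap-ε []       = refl
  foldMap-ε (x ∷ xs) = trans (identityˡ _) (foldMap-ε xs)

  foldMap-∙ : ∀ (f g : A → Carrier) xs → foldMap (λ x → f x ∙ g x) xs ≈ foldMap f xs ∙ foldMap g xs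
  foldMap-∙ f g []       = sym (identityˡ ε)
  foldMap-∙ f g (x ∷ xs) = trans (∙-congˡ (foldMap-∙ f g xs)) (interchange _ _ _ _)
    where open CommutativeSemigroupProperties commutativeSemigroup

  foldMap-comm : ∀ (f : A → B → Carrier) xs ys →
    foldMap (λ x → foldMap (f x) ys) xs ≈ foldMap (λ y → foldMap (λ x → f x y) xs) ys
  foldMap-comm f []       ys = sym (foldMap-ε ys)
  foldMap-comm f (x ∷ xs) ys =
    trans (∙-congˡ (foldMap-comm f xs ys)) (sym (foldMap-∙ (f x) _ ys))

  foldMap-↭ : ∀ (f : A → Carrier) {xs ys} → xs ↭ ys → foldMap f xs ≈ foldMap f ys
  foldMap-↭ f {xs} {ys} xs↭ys = begin
    foldMap f xs            ≡⟨ foldMap-map (λ x → x) f xs ⟨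
    foldr _∙_ ε (map f xs)
      ≈⟨ ↭ₛ.foldr-commMonoid setoid isCommutativeMonoid (↭⇒↭ₛ′ isEquivalence (↭.map⁺ f xs↭ys)) ⟩
    foldr _∙_ ε (map f ys)  ≡⟨ foldMap-map (λ x → x) f ys ⟩
    foldMap f ys            ∎

  foldMap-allFin : ∀ {n} (f : Fin n → Carrier) → foldMap f (allFin n) ≡ sum f
  foldMap-allFin {ℕ.zero}  f = ≡.refl
  foldMap-allFin {ℕ.suc n} f = ≡.cong (f zero ∙_) (≡.trans
    (≡.cong (foldMap f) (≡.sym (List.map-tabulate (λ i → i) suc)))
    (≡.trans (foldMap-map f suc (allFin n)) (foldMap-allFin (f ∘ suc))))

  infix 6 _when_

  -- Replacing the excluded terms by the neutral element makes a restricted sum run over the full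
  -- index set, where two summations can be exchanged. In the multiplicative monoid the excluded
  -- factors become 1.
  _when_ : ∀ {p} {P : Set p} → Carrier → Dec P → Carrier
  x when yes _ = x
  x when no  _ = ε

  when-true : ∀ {p} {P : Set p} {x} (P? : Dec P) → P → x when P? ≡ x
  when-true (yes _) p = ≡.refl
  when-true (no ¬p) p = contradiction p ¬p

  when-false : ∀ {p} {P : Set p} {x} (P? : Dec P) → ¬ P → x when P? ≡ ε
  when-false (yes p) ¬p = contradiction p ¬p
  when-false (no _)  ¬p = ≡.refl

  foldMap-filter : ∀ {p} {P : Pred A p} (P? : Decidable P) (f : A → Carrier) xs →
    foldMap f (filter P? xs) ≈ foldMap (λ x → f x when P? x) xs
  foldMap-filter P? f []       = refl
  foldMap-filter P? f (x ∷ xs) with P? x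
  ... | yes _ = ∙-congˡ (foldMap-filter P? f xs)
  ... | no  _ = trans (foldMap-filter P? f xs) (sym (identityˡ _))

  sum-ε : ∀ {n} (f : Fin n → Carrier) → (∀ i → f i ≈ ε) → sum f ≈ ε
  sum-ε {n} f f≈ε = trans (sum-cong-≋ f≈ε) (sum-replicate-zero n)

  sum-single : ∀ {n} (f : Fin n → Carrier) i → (∀ j → j ≢ i → f j ≈ ε) → sum f ≈ f i
  sum-single f zero    f≈ε = trans (∙-congˡ (sum-ε (f ∘ suc) λ j → f≈ε (suc j) λ ())) (identityʳ _)
  sum-single f (suc i) f≈ε = trans (∙-cong (f≈ε zero λ ())
    (sum-single (f ∘ suc) i λ j j≢i → f≈ε (suc j) (j≢i ∘ Fin.suc-injective))) (identityˡ _)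

module SemiringListSum {c ℓ} (S : Semiring c ℓ) where
  open Semiring S
  open ListSum +-commutativeMonoid public

  *-distribˡ-foldMap : ∀ {a} {A : Set a} x (f : A → Carrier) xs →
    x * foldMap f xs ≈ foldMap (λ y → x * f y) xs
  *-distribˡ-foldMap x f []       = zeroʳ x
  *-distribˡ-foldMap x f (y ∷ xs) = trans (distribˡ x _ _) (+-congˡ (*-distribˡ-foldMap x f xs))

  *-distribʳ-foldMap : ∀ {a} {A : Set a} x (f : A → Carrier) xs →
    foldMap f xs * x ≈ foldMap (λ y → f y * x) xs
  *-distribʳ-foldMap x f []       = zeroˡ x
  *-distribʳ-foldMap x f (y ∷ xs) = trans (distribʳ x _ _) (+-congˡ (*-distribʳ-foldMap x f xs))

-- Negative equality and zero divisors in ℂ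

module ℂR = CommutativeRing ℂ-commutativeRing

∣p-0∣≡∣p∣ : ∀ p → ℚ.∣ p ℚ.- 0ℚ ∣ ≡ ℚ.∣ p ∣
∣p-0∣≡∣p∣ p = ≡.cong ℚ.∣_∣ (ℚ.+-identityʳ p)

0≤∣p∣ : ∀ p → 0ℚ ℚ.≤ ℚ.∣ p ∣
0≤∣p∣ p = ℚ.nonNegative⁻¹ ℚ.∣ p ∣ {{ℚ.∣-∣-nonNeg p}}

p*p≡∣p∣*∣p∣ : ∀ p → p ℚ.* p ≡ ℚ.∣ p ∣ ℚ.* ℚ.∣ p ∣
p*p≡∣p∣*∣p∣ p with ℚ.∣p∣≡p∨∣p∣≡-p p
... | inj₁ eq = ≡.sym (≡.cong₂ ℚ._*_ eq eq)
... | inj₂ eq = ≡.sym (≡.trans (≡.cong₂ ℚ._*_ eq eq)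
  (solve 1 (λ p → (:- p) :* (:- p) := p :* p) ≡.refl p))
  where open +-*-Solver

∣∣-mono-* : ∀ {p q} a b → 0ℚ ℚ.≤ q → p ℚ.≤ ℚ.∣ a ∣ → q ℚ.≤ ℚ.∣ b ∣ → p ℚ.* q ℚ.≤ ℚ.∣ a ∣ ℚ.* ℚ.∣ b ∣
∣∣-mono-* {p} {q} a b 0≤q p≤a q≤b = ℚ.≤-trans
  (ℚ.*-monoʳ-≤-nonNeg q {{ℚ.nonNegative 0≤q}} p≤a)
  (ℚ.*-monoˡ-≤-nonNeg ℚ.∣ a ∣ {{ℚ.∣-∣-nonNeg a}} q≤b)

0<p*q : ∀ {p q} → 0ℚ ℚ.< p → 0ℚ ℚ.< q → 0ℚ ℚ.< p ℚ.* q
0<p*q {p} {q} 0<p 0<q = ℚ.positive⁻¹ _ {{ℚ.pos*pos⇒pos p {{ℚ.positive 0<p}} q {{ℚ.positive 0<q}}}}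

<⇒≱ : ∀ {p q} → p ℚ.< q → ¬ (q ℚ.≤ p)
<⇒≱ p<q q≤p = ℚ.<-irrefl ≡.refl (ℚ.<-≤-trans p<q q≤p)

0ʳ : ℝ
0ʳ = fromℚ 0ℚ

EventuallyAbove : ℝ → ℚ → Set
EventuallyAbove x δ = ∃ λ N → ∀ n → N ℕ.≤ n → δ ℚ.≤ ℚ.∣ seq x n ∣

-- Equality of reals is a negative statement: this is what allows classical
-- reasoning about sums of character values.
unseparated⇒≈0 : ∀ x → (∀ δ → 0ℚ ℚ.< δ → ¬ EventuallyAbove x δ) → x ≈ʳ 0ʳ
unseparated⇒≈0 x unseparated = mk≈ null′
  where
  null′ : ∀ ε → 0ℚ ℚ.< ε → ∃ λ N → ∀ n → N ℕ.≤ n → ℚ.∣ seq x n ℚ.- 0ℚ ∣ ℚ.< ε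
  null′ ε 0<ε = N , λ n N≤n → ≡.subst (ℚ._< ε) (≡.sym (∣p-0∣≡∣p∣ (seq x n))) (small n N≤n)
    where
    -- The case distinction is made at the single index `N`, where it is a decidable comparison of
    -- rationals with `h = ε/2`. Beyond `N` the terms differ by less than `q = ε/4`: if the one at
    -- `N` is below `h`, they all stay below `ε`; otherwise none falls below `q`, because
    -- `q + q = h`.
    h = ε ℚ.* ½
    q = h ℚ.* ½
    double : ∀ p → p ℚ.* ½ ℚ.+ p ℚ.* ½ ≡ p
    double p = ≡.trans (≡.sym (ℚ.*-distribˡ-+ p ½ ½)) (ℚ.*-identityʳ p)
    0<h = 0<p*q 0<ε (ℚ.positive⁻¹ ½)
    0<q = 0<p*q 0<h (ℚ.positive⁻¹ ½)
    N = proj₁ (cauchy x q 0<q)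
    near = proj₂ (cauchy x q 0<q)
    open +-*-Solver

    q<h : q ℚ.< h
    q<h = ≡.subst₂ ℚ._<_ (ℚ.+-identityʳ q) (double h) (ℚ.+-monoʳ-< q 0<q)

    small : ∀ n → N ℕ.≤ n → ℚ.∣ seq x n ∣ ℚ.< ε
    small n N≤n with ℚ.∣ seq x N ∣ ℚ.<? h
    ... | yes xN<h = begin-strict
      ℚ.∣ seq x n ∣
        ≡⟨ ≡.cong ℚ.∣_∣ (solve 2 (λ a b → a := b :+ (a :- b)) ≡.refl (seq x n) (seq x N)) ⟩
      ℚ.∣ seq x N ℚ.+ (seq x n ℚ.- seq x N) ∣       ≤⟨ ℚ.∣p+q∣≤∣p∣+∣q∣ (seq x N) _ ⟩
      ℚ.∣ seq x N ∣ ℚ.+ ℚ.∣ seq x n ℚ.- seq x N ∣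
        <⟨ ℚ.+-mono-< xN<h (ℚ.<-trans (near n N N≤n ℕ.≤-refl) q<h) ⟩
      h ℚ.+ h                                       ≡⟨ double ε ⟩
      ε                                             ∎
      where open ℚ.≤-Reasoning
    ... | no xN≮h = ⊥-elim (unseparated q 0<q (N , λ m N≤m → ℚ.≮⇒≥ λ xm<q → xN≮h (begin-strict
      ℚ.∣ seq x N ∣
        ≡⟨ ≡.cong ℚ.∣_∣ (solve 2 (λ a b → a := b :+ (a :- b)) ≡.refl (seq x N) (seq x m)) ⟩
      ℚ.∣ seq x m ℚ.+ (seq x N ℚ.- seq x m) ∣       ≤⟨ ℚ.∣p+q∣≤∣p∣+∣q∣ (seq x m) _ ⟩
      ℚ.∣ seq x m ∣ ℚ.+ ℚ.∣ seq x N ℚ.- seq x m ∣   <⟨ ℚ.+-mono-< xm<q (near N m ℕ.≤-refl N≤m) ⟩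
      q ℚ.+ q                                       ≡⟨ double h ⟩
      h                                             ∎)))
      where open ℚ.≤-Reasoning

null₀ : ∀ {x} → x ≈ʳ 0ʳ → ∀ ε → 0ℚ ℚ.< ε → ∃ λ N → ∀ n → N ℕ.≤ n → ℚ.∣ seq x n ∣ ℚ.< ε
null₀ {x} x≈0 ε 0<ε = let (N , small) = null x≈0 ε 0<ε in
  N , λ n N≤n → ≡.subst (ℚ._< ε) (∣p-0∣≡∣p∣ (seq x n)) (small n N≤n)

-- By `unseparated⇒≈0` only a lower bound `δ` on the tail has to be refuted. As the goal is then a
-- contradiction, `x ≈ʳ 0ʳ` may be assumed.
≈0-stableʳ : ∀ x → ¬ ¬ (x ≈ʳ 0ʳ) → x ≈ʳ 0ʳ
≈0-stableʳ x ¬¬x≈0 = unseparated⇒≈0 x λ δ 0<δ (M , above) → ¬¬x≈0 λ x≈0 →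
  let (N , small) = null₀ x≈0 δ 0<δ in
  <⇒≱ (small (M ℕ.⊔ N) (ℕ.m≤n⊔m M N)) (above (M ℕ.⊔ N) (ℕ.m≤m⊔n M N))

-- If ∣x∣ stays above `δ`, then ∣xy∣ < δε forces ∣y∣ < ε, so that `y` would be null. A mere negation
-- about `y` is therefore enough.
x*y≈0⇒x≈0 : ∀ {x y} → x *ʳ y ≈ʳ 0ʳ → ¬ (y ≈ʳ 0ʳ) → x ≈ʳ 0ʳ
x*y≈0⇒x≈0 {x} {y} xy≈0 y≉0 = unseparated⇒≈0 x λ δ 0<δ (M , above) → y≉0 (mk≈ λ ε 0<ε →
  let (N , small) = null₀ xy≈0 (δ ℚ.* ε) (0<p*q 0<δ 0<ε) in
  M ℕ.⊔ N , λ n n≥ → ≡.subst (ℚ._< ε) (≡.sym (∣p-0∣≡∣p∣ (seq y n))) (ℚ.≰⇒> λ ε≤y →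
    <⇒≱ (≡.subst (ℚ._< δ ℚ.* ε) (ℚ.∣p*q∣≡∣p∣*∣q∣ (seq x n) (seq y n))
             (small n (ℕ.≤-trans (ℕ.m≤n⊔m M N) n≥)))
          (∣∣-mono-* (seq x n) (seq y n) (ℚ.<⇒≤ 0<ε) (above n (ℕ.≤-trans (ℕ.m≤m⊔n M N) n≥)) ε≤y)))

-- Squares of rationals are nonnegative, so a lower bound `δ` on ∣x∣ would give the lower bound δ²
-- on the sum.
x²+y²≈0⇒x≈0 : ∀ {x y} → x *ʳ x +ʳ y *ʳ y ≈ʳ 0ʳ → x ≈ʳ 0ʳ
x²+y²≈0⇒x≈0 {x} {y} x²+y²≈0 = unseparated⇒≈0 x λ δ 0<δ (M , above) →
  let (N , small) = null₀ x²+y²≈0 (δ ℚ.* δ) (0<p*q 0<δ 0<δ)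
      n = M ℕ.⊔ N
      a = seq x n
      b = seq y n
      δ≤a = above n (ℕ.m≤m⊔n M N)
      open ℚ.≤-Reasoning
  in <⇒≱ (small n (ℕ.m≤n⊔m M N)) (begin
    δ ℚ.* δ                                        ≤⟨ ∣∣-mono-* a a (ℚ.<⇒≤ 0<δ) δ≤a δ≤a ⟩
    ℚ.∣ a ∣ ℚ.* ℚ.∣ a ∣                            ≡⟨ ℚ.+-identityʳ _ ⟨
    ℚ.∣ a ∣ ℚ.* ℚ.∣ a ∣ ℚ.+ 0ℚ
      ≤⟨ ℚ.+-monoʳ-≤ (ℚ.∣ a ∣ ℚ.* ℚ.∣ a ∣)
           (∣∣-mono-* {0ℚ} {0ℚ} b b ℚ.≤-refl (0≤∣p∣ b) (0≤∣p∣ b)) ⟩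
    ℚ.∣ a ∣ ℚ.* ℚ.∣ a ∣ ℚ.+ ℚ.∣ b ∣ ℚ.* ℚ.∣ b ∣    ≡⟨ ≡.cong₂ ℚ._+_ (p*p≡∣p∣*∣p∣ a) (p*p≡∣p∣*∣p∣ b) ⟨
    a ℚ.* a ℚ.+ b ℚ.* b                            ≤⟨ p≤∣p∣ (a ℚ.* a ℚ.+ b ℚ.* b) ⟩
    ℚ.∣ a ℚ.* a ℚ.+ b ℚ.* b ∣                      ∎)
  where
  p≤∣p∣ : ∀ p → p ℚ.≤ ℚ.∣ p ∣
  p≤∣p∣ p with ℚ.≤-total 0ℚ p
  ... | inj₁ 0≤p = ℚ.≤-reflexive (≡.sym (ℚ.0≤p⇒∣p∣≡p 0≤p))
  ... | inj₂ p≤0 = ℚ.≤-trans p≤0 (0≤∣p∣ p)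

≈0-stable : ∀ {z} → ¬ ¬ (z ≈ᶜ ℂR.0#) → z ≈ᶜ ℂR.0#
≈0-stable {z} ¬¬z≈0 =
  ≈0-stableʳ (re z) (λ re≉0 → ¬¬z≈0 λ z≈0 → re≉0 (re≈ z≈0)) ,ᶜ
  ≈0-stableʳ (im z) (λ im≉0 → ¬¬z≈0 λ z≈0 → im≉0 (im≈ z≈0))

-- Multiplying `z w` by the conjugate of `w` gives `z` times the real number ∣w∣², which reduces the
-- claim to the real case for each part of `z`. The coefficients `c`, `d` and `-ʳ d` below are those
-- of the conjugate.
z*w≈0⇒z≈0 : ∀ {z w} → z *ᶜ w ≈ᶜ ℂR.0# → ¬ (w ≈ᶜ ℂR.0#) → z ≈ᶜ ℂR.0#
z*w≈0⇒z≈0 {z} {w} zw≈0 w≉0 =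
  x*y≈0⇒x≈0 (combine (re≈ zw≈0) (im≈ zw≈0) c d λ n →
    re-part (seq a n) (seq b n) (seq c n) (seq d n)) ∣w∣²≉0 ,ᶜ
  x*y≈0⇒x≈0 (combine (im≈ zw≈0) (re≈ zw≈0) c (-ʳ d) λ n →
    im-part (seq a n) (seq b n) (seq c n) (seq d n)) ∣w∣²≉0
  where
  open +-*-Solver
  a = re z
  b = im z
  c = re w
  d = im w
  ∣w∣²≉0 : ¬ (c *ʳ c +ʳ d *ʳ d ≈ʳ 0ʳ)
  ∣w∣²≉0 ∣w∣²≈0 = w≉0 (x²+y²≈0⇒x≈0 {c} {d} ∣w∣²≈0 ,ᶜ x²+y²≈0⇒x≈0 {d} {c} (≈ʳ-trans
    (≈ʳ-pointwise λ n → ℚ.+-comm (seq d n ℚ.* seq d n) (seq c n ℚ.* seq c n)) ∣w∣²≈0))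
  re-part : ∀ a b c d → a ℚ.* (c ℚ.* c ℚ.+ d ℚ.* d) ≡
    (a ℚ.* c ℚ.+ ℚ.- (b ℚ.* d)) ℚ.* c ℚ.+ (a ℚ.* d ℚ.+ b ℚ.* c) ℚ.* d
  re-part = solve 4 (λ a b c d → a :* (c :* c :+ d :* d) :=
    (a :* c :+ :- (b :* d)) :* c :+ (a :* d :+ b :* c) :* d) ≡.refl
  im-part : ∀ a b c d → b ℚ.* (c ℚ.* c ℚ.+ d ℚ.* d) ≡
    (a ℚ.* d ℚ.+ b ℚ.* c) ℚ.* c ℚ.+ (a ℚ.* c ℚ.+ ℚ.- (b ℚ.* d)) ℚ.* (ℚ.- d)
  im-part = solve 4 (λ a b c d → b :* (c :* c :+ d :* d) :=
    (a :* d :+ b :* c) :* c :+ (a :* c :+ :- (b :* d)) :* (:- d)) ≡.refl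
  combine : ∀ {x p q} → p ≈ʳ 0ʳ → q ≈ʳ 0ʳ → ∀ r s →
            (∀ n → seq x n ≡ seq p n ℚ.* seq r n ℚ.+ seq q n ℚ.* seq s n) → x ≈ʳ 0ʳ
  combine {x} {p} {q} p≈0 q≈0 r s eq =
    ≈ʳ-trans {y = p *ʳ r +ʳ q *ʳ s} (≈ʳ-pointwise eq)
    (≈ʳ-trans {y = 0ʳ *ʳ r +ʳ 0ʳ *ʳ s}
      (+ʳ-cong (*ʳ-cong p≈0 (≈ʳ-refl {r})) (*ʳ-cong q≈0 (≈ʳ-refl {s})))
      (≈ʳ-pointwise λ n → ≡.cong₂ ℚ._+_ (ℚ.*-zeroˡ (seq r n)) (ℚ.*-zeroˡ (seq s n))))

ofℚ-+ : ∀ p q → ofℚ (p ℚ.+ q) ≈ᶜ ofℚ p ℂR.+ ofℚ q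
ofℚ-+ p q = ≈ʳ-pointwise (λ _ → ≡.refl) ,ᶜ ≈ʳ-pointwise (λ _ → ≡.refl)

ofℚ-* : ∀ p q → ofℚ (p ℚ.* q) ≈ᶜ ofℚ p ℂR.* ofℚ q
ofℚ-* p q =
  ≈ʳ-pointwise (λ _ → solve 2 (λ p q → p :* q := p :* q :+ :- (con 0ℚ :* con 0ℚ)) ≡.refl p q) ,ᶜ
  ≈ʳ-pointwise (λ _ → solve 2 (λ p q → con 0ℚ := p :* con 0ℚ :+ con 0ℚ :* q) ≡.refl p q)
  where open +-*-Solver

-- The semiring of polynomials

-- Polynomials are compared through all ℂ-linear functionals on them, rather than
-- only through the coefficients: multiplication is then visibly compatible with
-- the equality, since evaluation at a product is an iterated evaluation.
module PolynomialSemiring (k : ℕ) where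
  open RawRing (polynomialRawRing k) using (_+_; _*_; 0#; 1#)
  open SemiringListSum ℂR.semiring
  open CommutativeSemigroupProperties ℂR.*-commutativeSemigroup using (x∙yz≈y∙xz)
  open SetoidReasoning ℂR.setoid

  infixl 6 _⊹_
  _⊹_ : Vec ℕ k → Vec ℕ k → Vec ℕ k
  _⊹_ = zipWith ℕ._+_

  linear : (Vec ℕ k → ℂ) → Polynomial k → ℂ
  linear F = foldMap λ (c , d) → c ℂR.* F d

  infix 4 _≋_
  record _≋_ (p q : Polynomial k) : Set where
    constructor mk≋
    field
      linear≈ : ∀ F → linear F p ℂR.≈ linear F q

  open _≋_ public

  linear-cong : ∀ {F G} p → (∀ d → F d ℂR.≈ G d) → linear F p ℂR.≈ linear G p
  linear-cong p F≈G = foldMap-cong p λ _ → ℂR.*-congˡ (F≈G _)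

  linear-+ : ∀ F p q → linear F (p + q) ℂR.≈ linear F p ℂR.+ linear F q
  linear-+ F = foldMap-++ _

  linear-* : ∀ F p q → linear F (p * q) ℂR.≈ linear (λ d → linear (λ d′ → F (d ⊹ d′)) q) p
  linear-* F p q = ℂR.trans (foldMap-cartesianProductWith _ _ p q)
    (foldMap-cong p λ { {c , d} _ → ℂR.trans
      (foldMap-cong q λ { {c′ , d′} _ → ℂR.*-assoc c c′ _ })
      (ℂR.sym (*-distribˡ-foldMap c _ q)) })

  -- A finite Fubini rule. Through `linear-*` it becomes the commutativity of the product of
  -- polynomials.
  linear-swap : ∀ (F : Vec ℕ k → Vec ℕ k → ℂ) p q →
    linear (λ d → linear (F d) q) p ℂR.≈ linear (λ d′ → linear (λ d → F d d′) p) q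
  linear-swap F p q = begin
    linear (λ d → linear (F d) q) p
      ≈⟨ foldMap-cong p (λ { {c , d} _ → *-distribˡ-foldMap c _ q }) ⟩
    foldMap (λ (c , d) → foldMap (λ (c′ , d′) → c ℂR.* (c′ ℂR.* F d d′)) q) p
      ≈⟨ foldMap-comm _ p q ⟩
    foldMap (λ (c′ , d′) → foldMap (λ (c , d) → c ℂR.* (c′ ℂR.* F d d′)) p) q
      ≈⟨ foldMap-cong q (λ { {c′ , d′} _ → ℂR.trans
           (foldMap-cong p λ { {c , d} _ → x∙yz≈y∙xz c c′ _ }) (ℂR.sym (*-distribˡ-foldMap c′ _ p)) }) ⟩
    linear (λ d′ → linear (λ d → F d d′) p) q
      ∎

  *-cong : ∀ {p p′ q q′} → p ≋ p′ → q ≋ q′ → p * q ≋ p′ * q′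
  *-cong {p} {p′} {q} {q′} p≋p′ q≋q′ = mk≋ λ F → begin
    linear F (p * q)                                  ≈⟨ linear-* F p q ⟩
    linear (λ d → linear (λ d′ → F (d ⊹ d′)) q) p     ≈⟨ linear≈ p≋p′ _ ⟩
    linear (λ d → linear (λ d′ → F (d ⊹ d′)) q) p′    ≈⟨ linear-cong p′ (λ d → linear≈ q≋q′ _) ⟩
    linear (λ d → linear (λ d′ → F (d ⊹ d′)) q′) p′   ≈⟨ linear-* F p′ q′ ⟨
    linear F (p′ * q′)                                ∎

  *-comm : ∀ p q → p * q ≋ q * p
  *-comm p q = mk≋ λ F → begin
    linear F (p * q)                                 ≈⟨ linear-* F p q ⟩
    linear (λ d → linear (λ d′ → F (d ⊹ d′)) q) p    ≈⟨ linear-swap (λ d d′ → F (d ⊹ d′)) p q ⟩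
    linear (λ d′ → linear (λ d → F (d ⊹ d′)) p) q
      ≈⟨ linear-cong q (λ d′ → linear-cong p λ d →
           ℂR.reflexive (≡.cong F (Vec.zipWith-comm ℕ.+-comm d d′))) ⟩
    linear (λ d′ → linear (λ d → F (d′ ⊹ d)) p) q    ≈⟨ linear-* F q p ⟨
    linear F (q * p)                                 ∎

  *-assoc : ∀ p q r → (p * q) * r ≋ p * (q * r)
  *-assoc p q r = mk≋ λ F → begin
    linear F ((p * q) * r)
      ≈⟨ linear-* F (p * q) r ⟩
    linear (λ e → linear (λ d″ → F (e ⊹ d″)) r) (p * q)
      ≈⟨ linear-* _ p q ⟩
    linear (λ d → linear (λ d′ → linear (λ d″ → F ((d ⊹ d′) ⊹ d″)) r) q) p
      ≈⟨ linear-cong p (λ d → linear-cong q λ d′ → linear-cong r λ d″ →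
           ℂR.reflexive (≡.cong F (Vec.zipWith-assoc ℕ.+-assoc d d′ d″))) ⟩
    linear (λ d → linear (λ d′ → linear (λ d″ → F (d ⊹ (d′ ⊹ d″))) r) q) p
      ≈⟨ linear-cong p (λ d → linear-* _ q r) ⟨
    linear (λ d → linear (λ e → F (d ⊹ e)) (q * r)) p
      ≈⟨ linear-* F p (q * r) ⟨
    linear F (p * (q * r))
      ∎

  linear-const-* : ∀ c F p → linear F (const c * p) ℂR.≈ c ℂR.* linear F p
  linear-const-* c F p = begin
    linear F (const c * p)                                     ≈⟨ linear-* F (const c) p ⟩
    c ℂR.* linear (λ d → F (replicate k 0 ⊹ d)) p ℂR.+ ℂR.0#   ≈⟨ ℂR.+-identityʳ _ ⟩
    c ℂR.* linear (λ d → F (replicate k 0 ⊹ d)) p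
      ≈⟨ ℂR.*-congˡ (linear-cong p λ d → ℂR.reflexive (≡.cong F (Vec.zipWith-identityˡ ℕ.+-identityˡ d))) ⟩
    c ℂR.* linear F p                                          ∎

  commutativeSemiring : CommutativeSemiring 0ℓ 0ℓ
  commutativeSemiring = record
    { Carrier = Polynomial k
    ; _≈_     = _≋_
    ; _+_     = _+_
    ; _*_     = _*_
    ; 0#      = 0#
    ; 1#      = 1#
    ; isCommutativeSemiring = isCommutativeSemiringˡ record
      { +-isCommutativeMonoid = record
        { isMonoid = record
          { isSemigroup = record
            { isMagma = record
              { isEquivalence = isEquivalence
              ; ∙-cong = λ {p} {p′} {q} {q′} p≋p′ q≋q′ → mk≋ λ F → ℂR.trans (linear-+ F p q)
                  (ℂR.trans (ℂR.+-cong (linear≈ p≋p′ F) (linear≈ q≋q′ F)) (ℂR.sym (linear-+ F p′ q′)))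
              }
            ; assoc = λ p q r → reflexive (List.++-assoc p q r)
            }
          ; identity = (λ p → ≋-refl) , (λ p → reflexive (List.++-identityʳ p))
          }
        ; comm = λ p q → mk≋ λ F → ℂR.trans (linear-+ F p q)
            (ℂR.trans (ℂR.+-comm _ _) (ℂR.sym (linear-+ F q p)))
        }
      ; *-isCommutativeMonoid = record
        { isMonoid = record
          { isSemigroup = record
            { isMagma = record { isEquivalence = isEquivalence ; ∙-cong = *-cong }
            ; assoc = *-assoc
            }
          ; identity = *-identityˡ , λ p → ≋-trans (*-comm p 1#) (*-identityˡ p)
          }
        ; comm = *-comm
        }
      ; distribʳ = λ r p q → mk≋ λ F → begin
          linear F ((p + q) * r)                      ≈⟨ linear-* F (p + q) r ⟩
          linear _ (p + q)                            ≈⟨ linear-+ _ p q ⟩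
          linear _ p ℂR.+ linear _ q                  ≈⟨ ℂR.+-cong (linear-* F p r) (linear-* F q r) ⟨
          linear F (p * r) ℂR.+ linear F (q * r)      ≈⟨ linear-+ F (p * r) (q * r) ⟨
          linear F (p * r + q * r)                    ∎
      ; zeroˡ = λ p → ≋-refl
      }
    }
    where
    ≋-refl : ∀ {p} → p ≋ p
    ≋-refl = mk≋ λ F → ℂR.refl
    ≋-trans : ∀ {p q r} → p ≋ q → q ≋ r → p ≋ r
    ≋-trans p≋q q≋r = mk≋ λ F → ℂR.trans (linear≈ p≋q F) (linear≈ q≋r F)
    reflexive : ∀ {p q} → p ≡ q → p ≋ q
    reflexive ≡.refl = ≋-refl
    isEquivalence : IsEquivalence _≋_
    isEquivalence = record
      { refl = ≋-refl ; sym = λ p≋q → mk≋ λ F → ℂR.sym (linear≈ p≋q F) ; trans = ≋-trans }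
    *-identityˡ : ∀ p → 1# * p ≋ p
    *-identityˡ p = mk≋ λ F → ℂR.trans (linear-const-* ℂR.1# F p) (ℂR.*-identityˡ _)

  const-isSemiringHomomorphism : IsSemiringHomomorphism
    (CommutativeSemiring.rawSemiring ℂR.commutativeSemiring)
    (CommutativeSemiring.rawSemiring commutativeSemiring) const
  const-isSemiringHomomorphism = record
    { isNearSemiringHomomorphism = record
      { +-isMonoidHomomorphism = record
        { isMagmaHomomorphism = record
          { isRelHomomorphism = record
            { cong = λ c≈c′ → mk≋ λ F → ℂR.+-congʳ (ℂR.*-congʳ c≈c′) }
          ; homo = λ c c′ → mk≋ λ F →
              ℂR.trans (ℂR.+-congʳ (ℂR.distribʳ _ c c′)) (ℂR.+-assoc _ _ _)
          }
        ; ε-homo = mk≋ λ F → ℂR.trans (ℂR.+-identityʳ _) (ℂR.zeroˡ _)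
        }
      ; *-homo = λ c c′ → mk≋ λ F → begin
          (c ℂR.* c′) ℂR.* F (replicate k 0) ℂR.+ ℂR.0#  ≈⟨ ℂR.+-identityʳ _ ⟩
          (c ℂR.* c′) ℂR.* F (replicate k 0)             ≈⟨ ℂR.*-assoc c c′ _ ⟩
          c ℂR.* (c′ ℂR.* F (replicate k 0))             ≈⟨ ℂR.*-congˡ (ℂR.+-identityʳ _) ⟨
          c ℂR.* linear F (const c′)                     ≈⟨ linear-const-* c F (const c′) ⟨
          linear F (const c * const c′)                  ∎
      }
    ; 1#-homo = mk≋ λ F → ℂR.refl
    }

  -- The Kronecker delta at `e`, extended linearly, reads off the coefficient at `e`. It is the
  -- functional by which `≋` yields `≈ₚ`.
  monomial : Vec ℕ k → Vec ℕ k → ℂ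
  monomial e d with ≡-dec ℕ._≟_ d e
  ... | yes _ = ℂR.1#
  ... | no  _ = ℂR.0#

  coeff≈linear : ∀ p e → coeff p e ℂR.≈ linear (monomial e) p
  coeff≈linear []            e = ℂR.refl
  coeff≈linear ((c , d) ∷ p) e with ≡-dec ℕ._≟_ d e
  ... | yes _ = ℂR.+-cong (ℂR.sym (ℂR.*-identityʳ c)) (coeff≈linear p e)
  ... | no  _ = ℂR.sym (ℂR.trans (ℂR.+-cong (ℂR.zeroʳ c) (ℂR.sym (coeff≈linear p e))) (ℂR.+-identityˡ _))

  ≋⇒≈ₚ : ∀ {p q} → p ≋ q → p ≈ₚ q
  ≋⇒≈ₚ {p} {q} p≋q = mk≈ₚ λ e → ℂR.trans (coeff≈linear p e)
    (ℂR.trans (linear≈ p≋q (monomial e)) (ℂR.sym (coeff≈linear q e)))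

-- Character sums

-- Injectivity is required only on the list, because `coordinates` is shown to be injective on
-- invariant vectors alone.
unique-map : ∀ {A B : Set} (f : A → B) {xs} →
  (∀ {x y} → x ∈ xs → y ∈ xs → f x ≡ f y → x ≡ y) → Unique xs → Unique (map f xs)
unique-map f injective []       = []
unique-map f injective (x∉xs ∷ unique) =
  All.map⁺ (All.tabulate λ y∈xs → All.lookup x∉xs y∈xs ∘ injective (here ≡.refl) (there y∈xs))
  ∷ unique-map f (λ x∈ y∈ → injective (there x∈) (there y∈)) unique

module Members (R : FiniteRing) where
  open FiniteRing R
  open Code R

  unique-allV : ∀ n → Unique (allV n)
  unique-allV ℕ.zero    = [] ∷ []
  unique-allV (ℕ.suc n) = Unique.cartesianProductWith⁺ Vec._∷_ Vec.∷-injective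
    (Unique.map⁺ (Injection.injective (↔⇒↣ enum)) (Unique.allFin⁺ card)) (unique-allV n)

  unique-members : ∀ {n} (X : SubsetV n) → Unique (members X)
  unique-members X = Unique.filter⁺ (member? X) (unique-allV _)

  ∈-members⁺ : ∀ {n} (X : SubsetV n) {v} → member X v → v ∈ members X
  ∈-members⁺ X = ∈-filter⁺ (member? X) (∈-allV _)

  ∈-members⁻ : ∀ {n} (X : SubsetV n) {v} → v ∈ members X → member X v
  ∈-members⁻ X v∈ = proj₂ (∈-filter⁻ (member? X) {xs = allV _} v∈)

  -- Both lists are free of repetitions, so having the same elements makes them permutations of each
  -- other. Sums over subsets are reindexed in this way, along translations of `D` and along
  -- `coordinates` from `V n` to `V t`.
  members-↭ : ∀ {m n} (X : SubsetV m) (Y : SubsetV n) (f : V m → V n) →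
    (∀ {u} → member X u → member Y (f u)) →
    (∀ {u v} → member X u → member X v → f u ≡ f v → u ≡ v) →
    (∀ {w} → member Y w → ∃ λ u → member X u × f u ≡ w) →
    map f (members X) ↭ members Y
  members-↭ X Y f f-member f-injective f-surjective = ∼bag⇒↭ (unique∧set⇒bag
    (unique-map f (λ u∈ v∈ → f-injective (∈-members⁻ X u∈) (∈-members⁻ X v∈)) (unique-members X))
    (unique-members Y)
    (mk⇔ to from))
    where
    to : ∀ {w} → w ∈ map f (members X) → w ∈ members Y
    to w∈ with (u , u∈ , ≡.refl) ← ∈-map⁻ f w∈ = ∈-members⁺ Y (f-member (∈-members⁻ X u∈))
    from : ∀ {w} → w ∈ members Y → w ∈ map f (members X)
    from w∈ with (u , u∈X , ≡.refl) ← f-surjective (∈-members⁻ Y w∈) = ∈-map⁺ f (∈-members⁺ X u∈X)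

module CharacterSums (R : FiniteRing) (χ : Character R) where
  open FiniteRing R
  open Code R
  open Members R
  open Ring ring using (zeroˡ; zeroʳ; distribʳ; +-identityˡ; -‿inverseʳ; -‿inverseˡ; semiring)
    renaming (+-assoc to +-assocᴿ; *-assoc to *-assocᴿ)
  open SemiringSum semiring using (sum-cong-≗; ∑-distrib-+; *-distribˡ-sum)
  open SemiringListSum ℂR.semiring
  open Character χ

  value-+ : ∀ x y → value (x + y) ℂR.≈ value x ℂR.* value y
  value-+ x y = val≈ (homo x y)

  value-0 : value 0# ℂR.≈ ℂR.1#
  value-0 = val≈ ε-homo

  private
    value-≡0 : ∀ {x} → x ≡ 0# → value x ℂR.≈ ℂR.1#
    value-≡0 ≡.refl = value-0

    trivial≈ˣ : ∀ x {y} → value x ℂR.≈ ℂR.1# → y ≡ 0# → ⟦ x ⟧ ≈ˣ ⟦ y ⟧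
    trivial≈ˣ x χx≈1 y≡0 = mk≈ˣ (ℂR.trans χx≈1 (ℂR.sym (value-≡0 y≡0)))

    trivialˡ : ∀ r → (∀ x → value (x * r) ℂR.≈ ℂR.1#) → _≈ᵏ_ R (_ᵏ^_ R r χ) (_ᵏ^_ R 0# χ)
    trivialˡ r trivial = mk≈ᵏ λ x → trivial≈ˣ (x * r) (trivial x) (zeroʳ x)

    trivialʳ : ∀ r → (∀ x → value (r * x) ℂR.≈ ℂR.1#) → _≈ᵏ_ R (_^ᵏ_ R χ r) (_^ᵏ_ R χ 0#)
    trivialʳ r trivial = mk≈ᵏ λ x → trivial≈ˣ (r * x) (trivial x) (zeroˡ x)

    value-transfer : ∀ r y z → _≈ᵏ_ R (_^ᵏ_ R χ z) (_ᵏ^_ R y χ) → value (z * r) ℂR.≈ value (r * y)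
    value-transfer r y z χ^z≈ʸχ = val≈ (_≈ᵏ_.⟦⟧≈ χ^z≈ʸχ r)

  -- If χ is right generating and trivial on R r, then every character is trivial
  -- at r, in particular the characters x ↦ χ (x y), so χ is trivial on r R.
  trivial-on-left-ideal : IsGenerating R χ → ∀ r → (∀ x → value (x * r) ℂR.≈ ℂR.1#) → r ≡ 0#
  trivial-on-left-ideal (inj₂ left) r trivial =
    IsLeftModuleIsomorphism.injective left (trivialˡ r trivial)
    where open LeftModuleMorphisms (leftRegular R) (leftDual R) using (module IsLeftModuleIsomorphism)
  trivial-on-left-ideal (inj₁ right) r trivial =
    IsRightModuleIsomorphism.injective right (trivialʳ r λ y →
      let (z , χ^z≈ʸχ) = IsRightModuleIsomorphism.surjective right (_ᵏ^_ R y χ)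
      in ℂR.trans (ℂR.sym (value-transfer r y z (χ^z≈ʸχ ≡.refl))) (trivial z))
    where open RightModuleMorphisms (rightRegular R) (rightDual R) using (module IsRightModuleIsomorphism)

  ⟨⟩-+ : ∀ {n} (u v w : V n) → ⟨ u V.+ᴹ v , w ⟩ ≡ ⟨ u , w ⟩ + ⟨ v , w ⟩
  ⟨⟩-+ u v w = ≡.trans
    (sum-cong-≗ λ i → ≡.trans (≡.cong (_* lookup w i) (Vec.lookup-zipWith _+_ i u v)) (distribʳ _ _ _))
    (∑-distrib-+ (λ i → lookup u i * lookup w i) (λ i → lookup v i * lookup w i))

  ⟨⟩-* : ∀ {n} r (u w : V n) → ⟨ r V.*ₗ u , w ⟩ ≡ r * ⟨ u , w ⟩
  ⟨⟩-* r u w = ≡.trans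
    (sum-cong-≗ λ i → ≡.trans (≡.cong (_* lookup w i) (Vec.lookup-map i (r *_) u)) (*-assocᴿ r _ _))
    (≡.sym (*-distribˡ-sum r λ i → lookup u i * lookup w i))

  module _ {n} (D : SubsetV n) (D-submodule : IsLeftSubmodule D) where
    open IsLeftSubmodule D-submodule

    translate-↭ : ∀ {u} → member D u → map (u V.+ᴹ_) (members D) ↭ members D
    translate-↭ {u} u∈D = members-↭ D D (u V.+ᴹ_) (+-closed u∈D) (λ _ _ → injective)
      (λ {w} w∈D → (neg V.+ᴹ w) , +-closed neg∈D w∈D , u+[-u+w]≡w w)
      where
      -- A submodule is given by closure under sums and scalars, so the negative of `u` is reached
      -- as a scalar multiple.
      neg = (- 1#) V.*ₗ u
      neg∈D = *ₗ-closed (- 1#) u∈D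
      neg≡-u : neg ≡ V.-ᴹ u
      neg≡-u = Vec.map-cong (RingProperties.-1*x≈-x ring) u
      neg+[u+w]≡w : ∀ w → neg V.+ᴹ (u V.+ᴹ w) ≡ w
      neg+[u+w]≡w w = ≡.trans (≡.sym (Vec.zipWith-assoc +-assocᴿ neg u w))
        (≡.trans (≡.cong (V._+ᴹ w) (≡.trans (≡.cong (V._+ᴹ u) neg≡-u) (Vec.zipWith-inverseˡ -‿inverseˡ u)))
                 (Vec.zipWith-identityˡ +-identityˡ w))
      u+[-u+w]≡w : ∀ w → u V.+ᴹ (neg V.+ᴹ w) ≡ w
      u+[-u+w]≡w w = ≡.trans (≡.sym (Vec.zipWith-assoc +-assocᴿ u neg w))
        (≡.trans (≡.cong (V._+ᴹ w) (≡.trans (≡.cong (u V.+ᴹ_) neg≡-u) (Vec.zipWith-inverseʳ -‿inverseʳ u)))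
                 (Vec.zipWith-identityˡ +-identityˡ w))
      injective : ∀ {v w} → u V.+ᴹ v ≡ u V.+ᴹ w → v ≡ w
      injective {v} {w} eq = ≡.trans (≡.sym (neg+[u+w]≡w v))
        (≡.trans (≡.cong (neg V.+ᴹ_) eq) (neg+[u+w]≡w w))

    characterSum : V n → ℂ
    characterSum w = foldMap (λ u → value ⟨ u , w ⟩) (members D)

    characterSum-dual : ∀ {w} → member (D ⊥ʳ) w →
      characterSum w ℂR.≈ foldMap (λ _ → ℂR.1#) (members D)
    characterSum-dual w∈D⊥ =
      foldMap-cong (members D) λ {u} u∈ → value-≡0 (w∈D⊥ u (∈-members⁻ D u∈))

    -- The factor shifts the summation variable by `u`, and this shift permutes `D`.
    characterSum-translate : ∀ {u} w → member D u →
      value ⟨ u , w ⟩ ℂR.* characterSum w ℂR.≈ characterSum w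
    characterSum-translate {u} w u∈D = begin
      value ⟨ u , w ⟩ ℂR.* characterSum w
        ≈⟨ *-distribˡ-foldMap _ _ (members D) ⟩
      foldMap (λ v → value ⟨ u , w ⟩ ℂR.* value ⟨ v , w ⟩) (members D)
        ≈⟨ foldMap-cong (members D) (λ {v} _ → ℂR.trans
             (ℂR.sym (value-+ ⟨ u , w ⟩ ⟨ v , w ⟩)) (ℂR.reflexive (≡.cong value (≡.sym (⟨⟩-+ u v w))))) ⟩
      foldMap (λ v → value ⟨ u V.+ᴹ v , w ⟩) (members D)
        ≡⟨ foldMap-map _ _ (members D) ⟨
      foldMap (λ v → value ⟨ v , w ⟩) (map (u V.+ᴹ_) (members D))
        ≈⟨ foldMap-↭ _ (translate-↭ u∈D) ⟩
      characterSum w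
        ∎
      where open SetoidReasoning ℂR.setoid

    -- Stability allows the sum S to be assumed nonzero. Translation gives (χ(⟨v , w⟩) - 1) S = 0
    -- for all `v` in `D`, hence χ(⟨v , w⟩) = 1. Applied to the multiples of any `u` in `D`, this
    -- makes χ trivial on the left ideal generated by ⟨u , w⟩; so ⟨u , w⟩ = 0 for every `u`, a
    -- contradiction.
    characterSum-nondual : IsGenerating R χ → ∀ {w} → ¬ member (D ⊥ʳ) w → characterSum w ℂR.≈ ℂR.0#
    characterSum-nondual χ-generating {w} w∉D⊥ = ≈0-stable λ S≉0 → w∉D⊥ λ u u∈D →
      trivial-on-left-ideal χ-generating ⟨ u , w ⟩ λ x → ℂR.trans
        (ℂR.reflexive (≡.cong value (≡.sym (⟨⟩-* x u w))))
        (z-1≈0⇒z≈1 (z*w≈0⇒z≈0 ([z-1]S≈0 (*ₗ-closed x u∈D)) S≉0))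
      where
      open RingProperties ℂR.ring using (-‿distribˡ-*)
      z-1≈0⇒z≈1 : ∀ {z} → z ℂR.- ℂR.1# ℂR.≈ ℂR.0# → z ℂR.≈ ℂR.1#
      z-1≈0⇒z≈1 = GroupProperties.x∙y⁻¹≈ε⇒x≈y ℂR.+-group _ _
      [z-1]S≈0 : ∀ {v} → member D v → (value ⟨ v , w ⟩ ℂR.- ℂR.1#) ℂR.* characterSum w ℂR.≈ ℂR.0#
      [z-1]S≈0 v∈D = ℂR.trans (ℂR.distribʳ _ _ _) (ℂR.trans
        (ℂR.+-cong (characterSum-translate w v∈D)
          (ℂR.trans (ℂR.sym (-‿distribˡ-* _ _)) (ℂR.-‿cong (ℂR.*-identityˡ _))))
        (ℂR.-‿inverseʳ _))

-- The MacWilliams identity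

-- `ℚ._/_` cancels a gcd, which does not compute for a variable `n`. The calculation is therefore
-- carried out on unnormalised fractions.
1/n*n≡1 : ∀ n .{{_ : ℕ.NonZero n}} → ((ℤ.+ 1) ℚ./ n) ℚ.* ((ℤ.+ n) ℚ./ 1) ≡ 1ℚ
1/n*n≡1 (ℕ.suc n) = ℚ.toℚᵘ-injective (begin
  ℚ.toℚᵘ (((ℤ.+ 1) ℚ./ ℕ.suc n) ℚ.* ((ℤ.+ ℕ.suc n) ℚ./ 1))
    ≈⟨ ℚ.toℚᵘ-homo-* ((ℤ.+ 1) ℚ./ ℕ.suc n) ((ℤ.+ ℕ.suc n) ℚ./ 1) ⟩
  ℚ.toℚᵘ ((ℤ.+ 1) ℚ./ ℕ.suc n) ℚᵘ.* ℚ.toℚᵘ ((ℤ.+ ℕ.suc n) ℚ./ 1)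
    ≈⟨ ℚᵘ.*-cong (ℚ.toℚᵘ-fromℚᵘ (mkℚᵘ (ℤ.+ 1) n)) (ℚ.toℚᵘ-fromℚᵘ (mkℚᵘ (ℤ.+ ℕ.suc n) 0)) ⟩
  mkℚᵘ (ℤ.+ 1) n ℚᵘ.* mkℚᵘ (ℤ.+ ℕ.suc n) 0
    ≈⟨ *≡* (≡.trans (ℤ.*-identityʳ _) (≡.cong (λ m → (ℤ.+ 1) ℤ.* (ℤ.+ m)) (≡.sym (ℕ.*-identityʳ (ℕ.suc n))))) ⟩
  ℚᵘ.1ℚᵘ
    ∎)
  where open SetoidReasoning ℚᵘ.≃-setoid

1+n/1 : ∀ n → (ℤ.+ ℕ.suc n) ℚ./ 1 ≡ 1ℚ ℚ.+ (ℤ.+ n) ℚ./ 1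
1+n/1 n = ℚ.toℚᵘ-injective (begin
  ℚ.toℚᵘ ((ℤ.+ ℕ.suc n) ℚ./ 1)                ≈⟨ ℚ.toℚᵘ-fromℚᵘ (mkℚᵘ (ℤ.+ ℕ.suc n) 0) ⟩
  mkℚᵘ (ℤ.+ ℕ.suc n) 0                        ≈⟨ *≡* (≡.cong (ℤ._* (ℤ.+ 1)) (≡.cong (λ m → (ℤ.+ 1) ℤ.+ m) (≡.sym (ℤ.*-identityʳ (ℤ.+ n))))) ⟩
  ℚᵘ.1ℚᵘ ℚᵘ.+ mkℚᵘ (ℤ.+ n) 0                  ≈⟨ ℚᵘ.+-congʳ ℚᵘ.1ℚᵘ (ℚ.toℚᵘ-fromℚᵘ (mkℚᵘ (ℤ.+ n) 0)) ⟨
  ℚᵘ.1ℚᵘ ℚᵘ.+ ℚ.toℚᵘ ((ℤ.+ n) ℚ./ 1)          ≈⟨ ℚ.toℚᵘ-homo-+ 1ℚ ((ℤ.+ n) ℚ./ 1) ⟨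
  ℚ.toℚᵘ (1ℚ ℚ.+ (ℤ.+ n) ℚ./ 1)               ∎)
  where open SetoidReasoning ℚᵘ.≃-setoid

module _ where
  open ListSum ℂR.+-commutativeMonoid

  foldMap-1 : ∀ {A : Set} (xs : List A) → foldMap (λ _ → ℂR.1#) xs ℂR.≈ ofℚ ((ℤ.+ length xs) ℚ./ 1)
  foldMap-1 []       = ℂR.refl
  foldMap-1 (x ∷ xs) = ℂR.trans (ℂR.+-congˡ (foldMap-1 xs))
    (ℂR.trans (ℂR.sym (ofℚ-+ 1ℚ ((ℤ.+ length xs) ℚ./ 1)))
      (ℂR.reflexive (≡.cong ofℚ (≡.sym (1+n/1 (length xs))))))

  1/length*length : ∀ {A : Set} (xs : List A) .{{_ : ℕ.NonZero (length xs)}} →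
    ofℚ ((ℤ.+ 1) ℚ./ length xs) ℂR.* foldMap (λ _ → ℂR.1#) xs ℂR.≈ ℂR.1#
  1/length*length xs = ℂR.trans (ℂR.*-congˡ (foldMap-1 xs))
    (ℂR.trans (ℂR.sym (ofℚ-* ((ℤ.+ 1) ℚ./ length xs) ((ℤ.+ length xs) ℚ./ 1)))
      (ℂR.reflexive (≡.cong ofℚ (1/n*n≡1 (length xs)))))

-- Polynomials enter only as a commutative semiring that receives ℂ through `κ`. The one argument by
-- subtraction, the vanishing of character sums, takes place in ℂ.
module MacWilliams (R : FiniteRing) (χ : Character R) (P : CommutativeSemiring 0ℓ 0ℓ)
  (κ : ℂ → CommutativeSemiring.Carrier P)
  (κ-homomorphism : IsSemiringHomomorphism
    (CommutativeSemiring.rawSemiring ℂR.commutativeSemiring) (CommutativeSemiring.rawSemiring P) κ)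
  where
  private module P = CommutativeSemiring P

  open FiniteRing R
  open Code R hiding (transform) renaming (sum to sumᴿ)
  open Members R
  open CharacterSums R χ
  open Character χ using (value)
  open IsSemiringHomomorphism κ-homomorphism
    renaming (⟦⟧-cong to κ-cong; +-homo to κ-+; *-homo to κ-*; 0#-homo to κ-0; 1#-homo to κ-1) using ()
  open SemiringListSum P.semiring
  open SemiringSum P.semiring using (sum)
  open CommutativeMonoidSum P.*-commutativeMonoid using () renaming (sum to product; sum-cong-≋ to product-cong)
  open SetoidReasoning P.setoid

  foldMap-allElements : ∀ (f : Carrier → P.Carrier) → foldMap f allElements ≡ sum (f ∘ element)
  foldMap-allElements f = ≡.trans (foldMap-map f element (allFin card)) (foldMap-allFin (f ∘ element))

  -- For polynomials and `κ = const` this unfolds to `Code.transform χ`, so the final instance needs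
  -- no conversion.
  transform : (Carrier → P.Carrier) → Carrier → P.Carrier
  transform z a = sum λ i → κ (value (a * element i)) P.* z (element i)

  -- Expanding the product selects one ring element from each of the `t` factors, and such a
  -- selection is a vector of R^t. The recursion of `allV` is the one of this expansion.
  product-foldMap : ∀ {t} (g : Fin t → Carrier → P.Carrier) →
    product (λ i → foldMap (g i) allElements) P.≈ foldMap (λ w → product λ i → g i (lookup w i)) (allV t)
  product-foldMap {ℕ.zero}  g = P.sym (P.+-identityʳ P.1#)
  product-foldMap {ℕ.suc t} g = begin
    foldMap (g zero) allElements P.* product (λ i → foldMap (g (suc i)) allElements)
      ≈⟨ P.*-congˡ (product-foldMap (g ∘ suc)) ⟩
    foldMap (g zero) allElements P.* foldMap G (allV t)
      ≈⟨ *-distribʳ-foldMap _ (g zero) allElements ⟩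
    foldMap (λ a → g zero a P.* foldMap G (allV t)) allElements
      ≈⟨ foldMap-cong allElements (λ {a} _ → *-distribˡ-foldMap (g zero a) G (allV t)) ⟩
    foldMap (λ a → foldMap (λ w → g zero a P.* G w) (allV t)) allElements
      ≈⟨ foldMap-cartesianProductWith _ Vec._∷_ allElements (allV t) ⟨
    foldMap (λ w → product λ i → g i (lookup w i)) (allV (ℕ.suc t))
      ∎
    where G = λ w → product λ i → g (suc i) (lookup w i)

  κ-foldMap : ∀ {A : Set} (f : A → ℂ) xs →
    κ (ListSum.foldMap ℂR.+-commutativeMonoid f xs) P.≈ foldMap (λ x → κ (f x)) xs
  κ-foldMap f []       = κ-0
  κ-foldMap f (x ∷ xs) = P.trans (κ-+ (f x) _) (P.+-congˡ (κ-foldMap f xs))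

  product-value : ∀ {t} (f : Fin t → Carrier) (h : Fin t → P.Carrier) →
    product (λ i → κ (value (f i)) P.* h i) P.≈ κ (value (sumᴿ f)) P.* product h
  product-value {ℕ.zero}  f h = P.sym (P.trans (P.*-congʳ (P.trans (κ-cong value-0) κ-1)) (P.*-identityˡ P.1#))
  product-value {ℕ.suc t} f h = begin
    (κ (value (f zero)) P.* h zero) P.* product (λ i → κ (value (f (suc i))) P.* h (suc i))
      ≈⟨ P.*-congˡ (product-value (f ∘ suc) (h ∘ suc)) ⟩
    (κ (value (f zero)) P.* h zero) P.* (κ (value (sumᴿ (f ∘ suc))) P.* product (h ∘ suc))
      ≈⟨ interchange _ _ _ _ ⟩
    (κ (value (f zero)) P.* κ (value (sumᴿ (f ∘ suc)))) P.* product h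
      ≈⟨ P.*-congʳ (κ-* _ _) ⟨
    κ (value (f zero) ℂR.* value (sumᴿ (f ∘ suc))) P.* product h
      ≈⟨ P.*-congʳ (κ-cong (value-+ (f zero) _)) ⟨
    κ (value (sumᴿ f)) P.* product h
      ∎
    where open CommutativeSemigroupProperties P.*-commutativeSemigroup using (interchange)

  weight : ∀ {t} → (Fin t → Carrier → P.Carrier) → V t → P.Carrier
  weight z w = product λ i → z i (lookup w i)

  -- The Fourier transform of a product function on R^t is the product of the transforms in each
  -- variable: the character values multiply to the value at ⟨u , w⟩.
  weight-transform : ∀ {t} (z : Fin t → Carrier → P.Carrier) (u : V t) →
    weight (λ i → transform (z i)) u P.≈ foldMap (λ w → κ (value ⟨ u , w ⟩) P.* weight z w) (allV t)
  weight-transform z u = begin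
    weight (λ i → transform (z i)) u
      ≈⟨ product-cong (λ i → P.reflexive (≡.sym (foldMap-allElements (term i)))) ⟩
    product (λ i → foldMap (term i) allElements)
      ≈⟨ product-foldMap term ⟩
    foldMap (λ w → product λ i → term i (lookup w i)) (allV _)
      ≈⟨ foldMap-cong (allV _) (λ {w} _ → product-value (λ i → lookup u i * lookup w i) _) ⟩
    foldMap (λ w → κ (value ⟨ u , w ⟩) P.* weight z w) (allV _)
      ∎
    where
    term : ∀ i → Carrier → P.Carrier
    term i b = κ (value (lookup u i * b)) P.* z i b

  module _ {t} (χ-generating : IsGenerating R χ) (D : SubsetV t) (D-submodule : IsLeftSubmodule D)
           (z : Fin t → Carrier → P.Carrier) where

    private
      -- As a sum of ones, the cardinality has the form in which `characterSum-dual` produces it.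
      ∣D∣ : ℂ
      ∣D∣ = ListSum.foldMap ℂR.+-commutativeMonoid (λ _ → ℂR.1#) (members D)

    κ-characterSum : ∀ w → κ (characterSum D D-submodule w) P.* weight z w P.≈
      κ ∣D∣ P.* weight z w when member? (D ⊥ʳ) w
    κ-characterSum w with member? (D ⊥ʳ) w
    ... | yes w∈D⊥ = P.*-congʳ (κ-cong (characterSum-dual D D-submodule {w} w∈D⊥))
    ... | no  w∉D⊥ = P.trans (P.*-congʳ
      (P.trans (κ-cong (characterSum-nondual D D-submodule χ-generating {w} w∉D⊥)) κ-0)) (P.zeroˡ _)

    -- Poisson summation cleared of its denominator. Once the sums are exchanged, the inner sum over
    -- `D` is a character sum, which selects the `w` in the dual.
    transform-sum : foldMap (weight λ i → transform (z i)) (members D) P.≈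
                    κ ∣D∣ P.* foldMap (weight z) (members (D ⊥ʳ))
    transform-sum = begin
      foldMap (weight λ i → transform (z i)) (members D)
        ≈⟨ foldMap-cong (members D) (λ {u} _ → weight-transform z u) ⟩
      foldMap (λ u → foldMap (λ w → κ (value ⟨ u , w ⟩) P.* weight z w) (allV t)) (members D)
        ≈⟨ foldMap-comm _ (members D) (allV t) ⟩
      foldMap (λ w → foldMap (λ u → κ (value ⟨ u , w ⟩) P.* weight z w) (members D)) (allV t)
        ≈⟨ foldMap-cong (allV t) (λ {w} _ → P.trans
             (P.sym (*-distribʳ-foldMap (weight z w) _ (members D)))
             (P.*-congʳ (P.sym (κ-foldMap (λ u → value ⟨ u , w ⟩) (members D))))) ⟩
      foldMap (λ w → κ (characterSum D D-submodule w) P.* weight z w) (allV t)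
        ≈⟨ foldMap-cong (allV t) (λ {w} _ → κ-characterSum w) ⟩
      foldMap (λ w → κ ∣D∣ P.* weight z w when member? (D ⊥ʳ) w) (allV t)
        ≈⟨ foldMap-filter (member? (D ⊥ʳ)) _ (allV t) ⟨
      foldMap (λ w → κ ∣D∣ P.* weight z w) (members (D ⊥ʳ))
        ≈⟨ *-distribˡ-foldMap (κ ∣D∣) (weight z) (members (D ⊥ʳ)) ⟨
      κ ∣D∣ P.* foldMap (weight z) (members (D ⊥ʳ))
        ∎

    macWilliams : .{{_ : ℕ.NonZero (size D)}} →
      foldMap (weight z) (members (D ⊥ʳ)) P.≈
      κ (ofℚ ((ℤ.+ 1) ℚ./ size D)) P.* foldMap (weight λ i → transform (z i)) (members D)
    macWilliams = begin
      foldMap (weight z) (members (D ⊥ʳ))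
        ≈⟨ P.*-identityˡ _ ⟨
      P.1# P.* foldMap (weight z) (members (D ⊥ʳ))
        ≈⟨ P.*-congʳ (P.trans (P.sym (κ-* 1/∣D∣ ∣D∣)) (P.trans (κ-cong (1/length*length (members D))) κ-1)) ⟨
      (κ 1/∣D∣ P.* κ ∣D∣) P.* foldMap (weight z) (members (D ⊥ʳ))
        ≈⟨ P.*-assoc _ _ _ ⟩
      κ 1/∣D∣ P.* (κ ∣D∣ P.* foldMap (weight z) (members (D ⊥ʳ)))
        ≈⟨ P.*-congˡ transform-sum ⟨
      κ 1/∣D∣ P.* foldMap (weight λ i → transform (z i)) (members D)
        ∎
      where 1/∣D∣ = ofℚ ((ℤ.+ 1) ℚ./ size D)

-- Complete Jacobi polynomials as sums of products

-- The powers in CJ are stuck on their exponent and carry the equality of the raw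
-- semiring, so that equality is left arbitrary: P need not use the one of CJ.
module CompleteJacobi (R : FiniteRing) (P : CommutativeSemiring 0ℓ 0ℓ)
  (_~_ : Rel (CommutativeSemiring.Carrier P) 0ℓ) where
  private module P = CommutativeSemiring P

  open FiniteRing R
  open Code R hiding (_×ᴿ_; sum)
  open ListSum P.+-commutativeMonoid using (foldMap; foldMap-cong)

  rawSemiring : RawSemiring 0ℓ 0ℓ
  rawSemiring = record P.rawSemiring { _≈_ = _~_ }

  module Π = ListSum P.*-commutativeMonoid
  open Π using (_when_; when-true; when-false; sum-single)
  open CommutativeMonoidSum P.*-commutativeMonoid using ()
    renaming (sum to product; sum-cong-≋ to product-cong; ∑-distrib-+ to product-*; ∑-comm to product-comm)
  open RawSemiringOps rawSemiring using (_^_)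
  open SetoidReasoning P.setoid

  ^-length : ∀ {A : Set} x (xs : List A) → x ^ length xs ≡ Π.foldMap (λ _ → x) xs
  ^-length x []       = ≡.refl
  ^-length x (_ ∷ xs) = ≡.cong (x P.*_) (^-length x xs)

  ^-length-filter : ∀ {t} {Q : Pred (Fin t) 0ℓ} (Q? : Decidable Q) x →
    x ^ length (filter Q? (allFin t)) P.≈ product (λ i → x when Q? i)
  ^-length-filter {t} Q? x = begin
    x ^ length (filter Q? (allFin t))             ≡⟨ ^-length x (filter Q? (allFin t)) ⟩
    Π.foldMap (λ _ → x) (filter Q? (allFin t))    ≈⟨ Π.foldMap-filter Q? (λ _ → x) (allFin t) ⟩
    Π.foldMap (λ i → x when Q? i) (allFin t)      ≡⟨ Π.foldMap-allFin (λ i → x when Q? i) ⟩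
    product (λ i → x when Q? i)                   ∎

  choose : ∀ {t} → Subset t → (Carrier → P.Carrier) → (Carrier → P.Carrier) → Fin t → Carrier → P.Carrier
  choose T x y i with i ∈? T
  ... | yes _ = x
  ... | no  _ = y

  module _ {n} {H : PermutationGroup n} (O : Orbits H) (T : Subset (Orbits.t O))
           (x y : Carrier → P.Carrier) where

    private
      factorˣ factorʸ factor : V n → Carrier → Fin (Orbits.t O) → P.Carrier
      factorˣ u a i = x a when (i ∈? T ×-dec (coordinate O u i ≟ a))
      factorʸ u a i = y a when (i ∈? ∁ T ×-dec (coordinate O u i ≟ a))
      factor  u a i = factorˣ u a i P.* factorʸ u a i

      factor-other : ∀ u a i → coordinate O u i ≢ a → factor u a i P.≈ P.1#
      factor-other u a i uᵢ≢a = P.trans (P.*-cong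
        (P.reflexive (when-false (i ∈? T ×-dec (coordinate O u i ≟ a)) (uᵢ≢a ∘ proj₂)))
        (P.reflexive (when-false (i ∈? ∁ T ×-dec (coordinate O u i ≟ a)) (uᵢ≢a ∘ proj₂))))
        (P.*-identityˡ P.1#)

      factor-own : ∀ u i → factor u (coordinate O u i) i P.≈ choose T x y i (coordinate O u i)
      factor-own u i with i ∈? T
      ... | yes i∈T = P.trans (P.*-cong
        (P.reflexive (when-true (yes i∈T ×-dec (coordinate O u i ≟ coordinate O u i)) (i∈T , ≡.refl)))
        (P.reflexive (when-false (i ∈? ∁ T ×-dec (coordinate O u i ≟ coordinate O u i)) λ (i∈∁T , _) → x∈∁p⇒x∉p i∈∁T i∈T)))
        (P.*-identityʳ _)
      ... | no i∉T = P.trans (P.*-cong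
        (P.reflexive (when-false {x = x (coordinate O u i)} (no i∉T ×-dec (coordinate O u i ≟ coordinate O u i)) λ (i∈T , _) → i∉T i∈T))
        (P.reflexive (when-true (i ∈? ∁ T ×-dec (coordinate O u i ≟ coordinate O u i)) (x∉p⇒x∈∁p i∉T , ≡.refl))))
        (P.*-identityˡ _)

    -- Each exponent counts positions, so each power is a product over positions with trivial
    -- factors elsewhere. After exchanging the product over ring elements with the one over
    -- positions, only the element `a = u_i` contributes at position `i`; `sum-single`, taken in the
    -- multiplicative monoid, isolates it.
    product-occurrences : ∀ u →
      product (λ j → (x (element j) ^ occurrences O (element j) T u) P.*
                     (y (element j) ^ occurrences O (element j) (∁ T) u)) P.≈
      product (λ i → choose T x y i (coordinate O u i))
    product-occurrences u = begin
      product (λ j → (x (element j) ^ occurrences O (element j) T u) P.*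
                     (y (element j) ^ occurrences O (element j) (∁ T) u))
        ≈⟨ product-cong (λ j → P.trans
             (P.*-cong (^-length-filter (λ i → i ∈? T ×-dec (coordinate O u i ≟ element j)) _)
                       (^-length-filter (λ i → i ∈? ∁ T ×-dec (coordinate O u i ≟ element j)) _))
             (P.sym (product-* (factorˣ u (element j)) (factorʸ u (element j))))) ⟩
      product (λ j → product λ i → factor u (element j) i)
        ≈⟨ product-comm (λ j i → factor u (element j) i) ⟩
      product (λ i → product λ j → factor u (element j) i)
        ≈⟨ product-cong (λ i → begin
             product (λ j → factor u (element j) i)
               ≈⟨ sum-single (λ j → factor u (element j) i) (index (coordinate O u i))
                    (λ j j≢ → factor-other u (element j) i λ uᵢ≡ →
                      j≢ (≡.sym (Inverse.inverseʳ enum uᵢ≡))) ⟩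
             factor u (element (index (coordinate O u i))) i
               ≡⟨ ≡.cong (λ a → factor u a i) (Inverse.inverseˡ enum ≡.refl) ⟩
             factor u (coordinate O u i) i
               ≈⟨ factor-own u i ⟩
             choose T x y i (coordinate O u i)
               ∎) ⟩
      product (λ i → choose T x y i (coordinate O u i))
        ∎

    CJ-product : ∀ D → CJ O rawSemiring D T x y P.≈
      foldMap (λ u → product λ i → choose T x y i (coordinate O u i)) (members D)
    CJ-product D = foldMap-cong (members D) λ {u} _ → product-occurrences u

-- Averaging over a permutation group

lookup-injective : ∀ {A : Set} {n} {u v : Vec.Vec A n} → (∀ i → lookup u i ≡ lookup v i) → u ≡ v
lookup-injective {u = u} {v} eq = ≡.trans (≡.sym (Vec.tabulate∘lookup u))
  (≡.trans (Vec.tabulate-cong eq) (Vec.tabulate∘lookup v))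

module GroupAction {n} (H : PermutationGroup n) where

  infixl 5 _▷_ _◁_
  infixl 6 _⋆_
  infix  8 _⁻¹
  _▷_ _◁_ : Fin n → Fin (order H) → Fin n
  j ▷ h = perm H h ⟨$⟩ʳ j
  j ◁ h = perm H h ⟨$⟩ˡ j

  _⋆_ : Fin (order H) → Fin (order H) → Fin (order H)
  g ⋆ h = proj₁ (∘-closed H g h)

  _⁻¹ : Fin (order H) → Fin (order H)
  g ⁻¹ = proj₁ (inv-closed H g)

  ▷-⋆ : ∀ j g h → j ▷ (g ⋆ h) ≡ j ▷ g ▷ h
  ▷-⋆ j g h = proj₂ (∘-closed H g h) j

  ▷-⁻¹ : ∀ j g → j ▷ (g ⁻¹) ≡ j ◁ g
  ▷-⁻¹ j g = proj₂ (inv-closed H g) j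

  ▷-◁ : ∀ j g → j ▷ g ◁ g ≡ j
  ▷-◁ j g = Perm.inverseˡ (perm H g)

  ◁-▷ : ∀ j g → j ◁ g ▷ g ≡ j
  ◁-▷ j g = Perm.inverseʳ (perm H g)

  ◁-unique : ∀ {j k} g → k ▷ g ≡ j → j ◁ g ≡ k
  ◁-unique {j} {k} g ≡.refl = ▷-◁ k g

  -- Identities between indices are checked on points, because `distinct` makes an index determined
  -- by its permutation.
  right-translation : Fin (order H) → Permutation′ (order H)
  right-translation g = permutation (_⋆ g) (_⋆ g ⁻¹)
    (λ h → distinct H λ j → begin
      j ▷ (h ⋆ g ⁻¹ ⋆ g)      ≡⟨ ▷-⋆ j (h ⋆ g ⁻¹) g ⟩
      j ▷ (h ⋆ g ⁻¹) ▷ g      ≡⟨ ≡.cong (_▷ g) (▷-⋆ j h (g ⁻¹)) ⟩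
      j ▷ h ▷ g ⁻¹ ▷ g        ≡⟨ ≡.cong (_▷ g) (▷-⁻¹ (j ▷ h) g) ⟩
      j ▷ h ◁ g ▷ g           ≡⟨ ◁-▷ (j ▷ h) g ⟩
      j ▷ h                   ∎)
    (λ h → distinct H λ j → begin
      j ▷ (h ⋆ g ⋆ g ⁻¹)      ≡⟨ ▷-⋆ j (h ⋆ g) (g ⁻¹) ⟩
      j ▷ (h ⋆ g) ▷ g ⁻¹      ≡⟨ ▷-⁻¹ (j ▷ (h ⋆ g)) g ⟩
      j ▷ (h ⋆ g) ◁ g         ≡⟨ ≡.cong (_◁ g) (▷-⋆ j h g) ⟩
      j ▷ h ▷ g ◁ g           ≡⟨ ▷-◁ (j ▷ h) g ⟩
      j ▷ h                   ∎)
    where open ≡-Reasoning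

  inversion : Permutation′ (order H)
  inversion = permutation _⁻¹ _⁻¹ involutive involutive
    where
    open ≡-Reasoning
    involutive : ∀ h → h ⁻¹ ⁻¹ ≡ h
    involutive h = distinct H λ j → begin
      j ▷ h ⁻¹ ⁻¹   ≡⟨ ▷-⁻¹ j (h ⁻¹) ⟩
      j ◁ h ⁻¹      ≡⟨ ◁-unique (h ⁻¹) (≡.trans (▷-⁻¹ (j ▷ h) h) (▷-◁ j h)) ⟩
      j ▷ h         ∎

  ◁-⋆ : ∀ j g h → j ◁ (g ⋆ h) ≡ j ◁ h ◁ g
  ◁-⋆ j g h = ◁-unique (g ⋆ h) (≡.trans (▷-⋆ _ g h)
    (≡.trans (≡.cong (_▷ h) (◁-▷ (j ◁ h) g)) (◁-▷ j h)))

  inOrbit-refl : ∀ j → InOrbit H j j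
  inOrbit-refl j = proj₁ (id-closed H) , proj₂ (id-closed H) j

  inOrbit-sym : ∀ {j k} → InOrbit H j k → InOrbit H k j
  inOrbit-sym (h , ≡.refl) = h ⁻¹ , ≡.trans (▷-⁻¹ _ h) (▷-◁ _ h)

  inOrbit-trans : ∀ {j k l} → InOrbit H j k → InOrbit H k l → InOrbit H j l
  inOrbit-trans (g , ≡.refl) (h , ≡.refl) = g ⋆ h , ▷-⋆ _ g h

  inOrbit-▷ : ∀ j g → InOrbit H j (j ▷ g)
  inOrbit-▷ j g = g , ≡.refl

  module _ (O : Orbits H) where
    open Orbits O

    orbitOf-spec : ∀ j → InOrbit H (α (orbitOf j)) j
    orbitOf-spec j = proj₂ (covering j)

    orbitOf-unique : ∀ {i j} → InOrbit H (α i) j → orbitOf j ≡ i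
    orbitOf-unique αi∼j = disjoint (inOrbit-trans (orbitOf-spec _) (inOrbit-sym αi∼j))

    orbitOf-▷ : ∀ j g → orbitOf (j ▷ g) ≡ orbitOf j
    orbitOf-▷ j g = orbitOf-unique (inOrbit-trans (orbitOf-spec j) (inOrbit-▷ j g))

module Averaging (R : FiniteRing) {n} (H : PermutationGroup n)
                 (∣H∣-unit : Code.OrderInvertible R H) where
  open FiniteRing R
  open Code R
  open GroupAction H
  open Ring ring using (semiring; distribˡ; *-assoc; *-identityˡ; *-identityʳ)
  open SemiringSum semiring hiding (sum)
  open SemiringMult semiring using (×-comm-*; ×-assoc-*)
  open ≡-Reasoning

  1/∣H∣ : Carrier
  1/∣H∣ = proj₁ ∣H∣-unit

  ×1-comm : ∀ k x → (k ×ᴿ 1#) * x ≡ x * (k ×ᴿ 1#)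
  ×1-comm k x = begin
    (k ×ᴿ 1#) * x    ≡⟨ ×-assoc-* k 1# x ⟩
    k ×ᴿ (1# * x)    ≡⟨ ≡.cong (k ×ᴿ_) (≡.trans (*-identityˡ x) (≡.sym (*-identityʳ x))) ⟩
    k ×ᴿ (x * 1#)    ≡⟨ ×-comm-* k x 1# ⟨
    x * (k ×ᴿ 1#)    ∎

  -- The inverse of a central unit is central: c x = c x N c = c N x c = x c. This lets the scalar
  -- of θ pass the entries of a vector in `θ-adjoint` and `θ-*`.
  1/∣H∣-comm : ∀ x → 1/∣H∣ * x ≡ x * 1/∣H∣
  1/∣H∣-comm x = begin
    c * x               ≡⟨ ≡.cong (c *_) (*-identityʳ x) ⟨
    c * (x * 1#)        ≡⟨ ≡.cong (λ y → c * (x * y)) (proj₂ (proj₂ ∣H∣-unit)) ⟨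
    c * (x * (N * c))   ≡⟨ ≡.cong (c *_) (*-assoc x N c) ⟨
    c * (x * N * c)     ≡⟨ ≡.cong (λ y → c * (y * c)) (×1-comm (order H) x) ⟨
    c * (N * x * c)     ≡⟨ ≡.cong (c *_) (*-assoc N x c) ⟩
    c * (N * (x * c))   ≡⟨ *-assoc c N (x * c) ⟨
    c * N * (x * c)     ≡⟨ ≡.cong (_* (x * c)) (proj₁ (proj₂ ∣H∣-unit)) ⟩
    1# * (x * c)        ≡⟨ *-identityˡ (x * c) ⟩
    x * c               ∎
    where
    c = 1/∣H∣
    N = order H ×ᴿ 1#

  θᴴ : V n → V n
  θᴴ = θ H ∣H∣-unit

  lookup-sumⱽ : ∀ {k} (f : Fin k → V n) j → lookup (sumⱽ f) j ≡ sum λ i → lookup (f i) j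
  lookup-sumⱽ {ℕ.zero}  f j = Vec.lookup-replicate j 0#
  lookup-sumⱽ {ℕ.suc k} f j = ≡.trans (Vec.lookup-zipWith _+_ j (f zero) _)
    (≡.cong (lookup (f zero) j +_) (lookup-sumⱽ (f ∘ suc) j))

  lookup-θ : ∀ v j → lookup (θᴴ v) j ≡ 1/∣H∣ * sum λ h → lookup v (j ◁ h)
  lookup-θ v j = ≡.trans (Vec.lookup-map j (1/∣H∣ *_) (sumⱽ λ h → v · perm H h))
    (≡.cong (1/∣H∣ *_) (≡.trans (lookup-sumⱽ (λ h → v · perm H h) j)
      (sum-cong-≗ λ h → Vec.lookup∘tabulate (λ i → lookup v (i ◁ h)) j)))

  Invariant : V n → Set
  Invariant v = ∀ j h → lookup v (j ▷ h) ≡ lookup v j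

  invariant-inOrbit : ∀ {v j k} → Invariant v → InOrbit H j k → lookup v k ≡ lookup v j
  invariant-inOrbit v-inv (h , ≡.refl) = v-inv _ h

  θ-invariant : ∀ v → Invariant (θᴴ v)
  θ-invariant v j g = begin
    lookup (θᴴ v) (j ▷ g)
      ≡⟨ lookup-θ v (j ▷ g) ⟩
    1/∣H∣ * sum (λ h → lookup v (j ▷ g ◁ h))
      -- With `h ⋆ g` in place of `h`, the inverse of `g` acts first and cancels the shift of `j`.
      ≡⟨ ≡.cong (1/∣H∣ *_) (sum-permute (λ h → lookup v (j ▷ g ◁ h)) (right-translation g)) ⟩
    1/∣H∣ * sum (λ h → lookup v (j ▷ g ◁ (h ⋆ g)))
      ≡⟨ ≡.cong (1/∣H∣ *_) (sum-cong-≗ λ h → ≡.cong (lookup v)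
           (≡.trans (◁-⋆ (j ▷ g) h g) (≡.cong (_◁ h) (▷-◁ j g)))) ⟩
    1/∣H∣ * sum (λ h → lookup v (j ◁ h))
      ≡⟨ lookup-θ v j ⟨
    lookup (θᴴ v) j
      ∎

  θ-fixes : ∀ {v} → Invariant v → θᴴ v ≡ v
  θ-fixes {v} v-inv = lookup-injective λ j → begin
    lookup (θᴴ v) j
      ≡⟨ lookup-θ v j ⟩
    1/∣H∣ * sum (λ h → lookup v (j ◁ h))
      ≡⟨ ≡.cong (1/∣H∣ *_) (sum-cong-≗ λ h → ≡.trans (≡.sym (v-inv (j ◁ h) h)) (≡.cong (lookup v) (◁-▷ j h))) ⟩
    1/∣H∣ * sum {order H} (λ _ → lookup v j)
      ≡⟨ ≡.cong (1/∣H∣ *_) (sum-replicate (order H)) ⟩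
    1/∣H∣ * (order H ×ᴿ lookup v j)
      ≡⟨ ≡.cong (λ x → 1/∣H∣ * (order H ×ᴿ x)) (*-identityˡ (lookup v j)) ⟨
    1/∣H∣ * (order H ×ᴿ (1# * lookup v j))
      ≡⟨ ≡.cong (1/∣H∣ *_) (×-assoc-* (order H) 1# (lookup v j)) ⟨
    1/∣H∣ * ((order H ×ᴿ 1#) * lookup v j)
      ≡⟨ *-assoc _ _ _ ⟨
    1/∣H∣ * (order H ×ᴿ 1#) * lookup v j
      ≡⟨ ≡.cong (_* lookup v j) (proj₁ (proj₂ ∣H∣-unit)) ⟩
    1# * lookup v j
      ≡⟨ *-identityˡ _ ⟩
    lookup v j
      ∎

  θ-idempotent : ∀ v → θᴴ (θᴴ v) ≡ θᴴ v
  θ-idempotent v = θ-fixes (θ-invariant v)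

  -- A permutation of the positions preserves the inner product, so the adjoint of `h` is its
  -- inverse. Inversion permutes `H` and leaves the average unchanged.
  θ-adjoint : ∀ v u → ⟨ v , θᴴ u ⟩ ≡ ⟨ θᴴ v , u ⟩
  θ-adjoint v u = begin
    sum (λ j → lookup v j * lookup (θᴴ u) j)
      ≡⟨ sum-cong-≗ (λ j → begin
           lookup v j * lookup (θᴴ u) j
             ≡⟨ ≡.cong (lookup v j *_) (lookup-θ u j) ⟩
           lookup v j * (c * sum λ h → lookup u (j ◁ h))
             ≡⟨ *-assoc (lookup v j) c _ ⟨
           lookup v j * c * sum (λ h → lookup u (j ◁ h))
             ≡⟨ ≡.cong (_* sum (λ h → lookup u (j ◁ h))) (1/∣H∣-comm (lookup v j)) ⟨
           c * lookup v j * sum (λ h → lookup u (j ◁ h))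
             ≡⟨ *-assoc c (lookup v j) _ ⟩
           c * (lookup v j * sum λ h → lookup u (j ◁ h))
             ≡⟨ ≡.cong (c *_) (*-distribˡ-sum (lookup v j) λ h → lookup u (j ◁ h)) ⟩
           c * sum (λ h → lookup v j * lookup u (j ◁ h))
             ∎) ⟩
    sum (λ j → c * sum λ h → lookup v j * lookup u (j ◁ h))
      ≡⟨ *-distribˡ-sum c (λ j → sum λ h → lookup v j * lookup u (j ◁ h)) ⟨
    c * sum (λ j → sum λ h → lookup v j * lookup u (j ◁ h))
      ≡⟨ ≡.cong (c *_) (∑-comm λ j h → lookup v j * lookup u (j ◁ h)) ⟩
    c * sum (λ h → sum λ j → lookup v j * lookup u (j ◁ h))
      ≡⟨ ≡.cong (c *_) (sum-cong-≗ λ h → ≡.trans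
           (sum-permute (λ j → lookup v j * lookup u (j ◁ h)) (perm H h))
           (sum-cong-≗ λ j → ≡.cong (λ k → lookup v (j ▷ h) * lookup u k) (▷-◁ j h))) ⟩
    c * sum (λ h → sum λ j → lookup v (j ▷ h) * lookup u j)
      ≡⟨ ≡.cong (c *_) (sum-permute (λ h → sum λ j → lookup v (j ▷ h) * lookup u j) inversion) ⟩
    c * sum (λ h → sum λ j → lookup v (j ▷ (h ⁻¹)) * lookup u j)
      ≡⟨ ≡.cong (c *_) (sum-cong-≗ λ h → sum-cong-≗ λ j → ≡.cong (λ k → lookup v k * lookup u j) (▷-⁻¹ j h)) ⟩
    c * sum (λ h → sum λ j → lookup v (j ◁ h) * lookup u j)
      ≡⟨ ≡.cong (c *_) (∑-comm λ h j → lookup v (j ◁ h) * lookup u j) ⟩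
    c * sum (λ j → sum λ h → lookup v (j ◁ h) * lookup u j)
      ≡⟨ *-distribˡ-sum c (λ j → sum λ h → lookup v (j ◁ h) * lookup u j) ⟩
    sum (λ j → c * sum λ h → lookup v (j ◁ h) * lookup u j)
      ≡⟨ sum-cong-≗ (λ j → begin
           c * sum (λ h → lookup v (j ◁ h) * lookup u j)
             ≡⟨ ≡.cong (c *_) (*-distribʳ-sum (lookup u j) λ h → lookup v (j ◁ h)) ⟨
           c * (sum (λ h → lookup v (j ◁ h)) * lookup u j)
             ≡⟨ *-assoc c _ _ ⟨
           c * sum (λ h → lookup v (j ◁ h)) * lookup u j
             ≡⟨ ≡.cong (_* lookup u j) (lookup-θ v j) ⟨
           lookup (θᴴ v) j * lookup u j
             ∎) ⟩
    sum (λ j → lookup (θᴴ v) j * lookup u j)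
      ∎
    where c = 1/∣H∣

  θ-+ : ∀ u v → θᴴ u V.+ᴹ θᴴ v ≡ θᴴ (u V.+ᴹ v)
  θ-+ u v = lookup-injective λ j → begin
    lookup (θᴴ u V.+ᴹ θᴴ v) j
      ≡⟨ Vec.lookup-zipWith _+_ j (θᴴ u) (θᴴ v) ⟩
    lookup (θᴴ u) j + lookup (θᴴ v) j
      ≡⟨ ≡.cong₂ _+_ (lookup-θ u j) (lookup-θ v j) ⟩
    1/∣H∣ * sum (λ h → lookup u (j ◁ h)) + 1/∣H∣ * sum (λ h → lookup v (j ◁ h))
      ≡⟨ distribˡ 1/∣H∣ _ _ ⟨
    1/∣H∣ * (sum (λ h → lookup u (j ◁ h)) + sum (λ h → lookup v (j ◁ h)))
      ≡⟨ ≡.cong (1/∣H∣ *_) (∑-distrib-+ (λ h → lookup u (j ◁ h)) (λ h → lookup v (j ◁ h))) ⟨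
    1/∣H∣ * sum (λ h → lookup u (j ◁ h) + lookup v (j ◁ h))
      ≡⟨ ≡.cong (1/∣H∣ *_) (sum-cong-≗ λ h → Vec.lookup-zipWith _+_ (j ◁ h) u v) ⟨
    1/∣H∣ * sum (λ h → lookup (u V.+ᴹ v) (j ◁ h))
      ≡⟨ lookup-θ (u V.+ᴹ v) j ⟨
    lookup (θᴴ (u V.+ᴹ v)) j
      ∎

  θ-* : ∀ r v → r V.*ₗ θᴴ v ≡ θᴴ (r V.*ₗ v)
  θ-* r v = lookup-injective λ j → begin
    lookup (r V.*ₗ θᴴ v) j
      ≡⟨ Vec.lookup-map j (r *_) (θᴴ v) ⟩
    r * lookup (θᴴ v) j
      ≡⟨ ≡.cong (r *_) (lookup-θ v j) ⟩
    r * (1/∣H∣ * sum (λ h → lookup v (j ◁ h)))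
      ≡⟨ *-assoc r 1/∣H∣ _ ⟨
    r * 1/∣H∣ * sum (λ h → lookup v (j ◁ h))
      ≡⟨ ≡.cong (_* sum (λ h → lookup v (j ◁ h))) (1/∣H∣-comm r) ⟨
    1/∣H∣ * r * sum (λ h → lookup v (j ◁ h))
      ≡⟨ *-assoc 1/∣H∣ r _ ⟩
    1/∣H∣ * (r * sum (λ h → lookup v (j ◁ h)))
      ≡⟨ ≡.cong (1/∣H∣ *_) (*-distribˡ-sum r λ h → lookup v (j ◁ h)) ⟩
    1/∣H∣ * sum (λ h → r * lookup v (j ◁ h))
      ≡⟨ ≡.cong (1/∣H∣ *_) (sum-cong-≗ λ h → Vec.lookup-map (j ◁ h) (r *_) v) ⟨
    1/∣H∣ * sum (λ h → lookup (r V.*ₗ v) (j ◁ h))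
      ≡⟨ lookup-θ (r V.*ₗ v) j ⟨
    lookup (θᴴ (r V.*ₗ v)) j
      ∎

-- The projected code and its dual

module Coordinates (R : FiniteRing) {n} {H : PermutationGroup n} (O : Orbits H)
                   (∣H∣-unit : Code.OrderInvertible R H) where
  open FiniteRing R
  open Code R
  open Orbits O
  open GroupAction H
  open Averaging R H ∣H∣-unit
  open Ring ring using (+-commutativeMonoid; semiring; zeroʳ; zeroˡ; *-identityˡ; +-identityˡ)
  open SemiringSum semiring hiding (sum)
  open ListSum +-commutativeMonoid using (_when_; when-true; when-false; sum-single)
  open ≡-Reasoning

  coordinates : V n → V t
  coordinates u = tabulate (coordinate O u)

  lookup-coordinates : ∀ u i → lookup (coordinates u) i ≡ lookup u (α i)
  lookup-coordinates u i = Vec.lookup∘tabulate (coordinate O u) i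

  coordinates-injective : ∀ {u v} → Invariant u → Invariant v → coordinates u ≡ coordinates v → u ≡ v
  coordinates-injective {u} {v} u-inv v-inv eq = lookup-injective λ j → begin
    lookup u j                            ≡⟨ invariant-inOrbit {u} u-inv (orbitOf-spec O j) ⟩
    lookup u (α (orbitOf j))              ≡⟨ lookup-coordinates u (orbitOf j) ⟨
    lookup (coordinates u) (orbitOf j)    ≡⟨ ≡.cong (λ w → lookup w (orbitOf j)) eq ⟩
    lookup (coordinates v) (orbitOf j)    ≡⟨ lookup-coordinates v (orbitOf j) ⟩
    lookup v (α (orbitOf j))              ≡⟨ invariant-inOrbit {v} v-inv (orbitOf-spec O j) ⟨
    lookup v j                            ∎

  lookup-*ᴹM : ∀ v j → lookup (v *ᴹ M O) j ≡ lookup v j * (ℓ j ×ᴿ 1#)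
  lookup-*ᴹM v j = begin
    lookup (v *ᴹ M O) j
      ≡⟨ Vec.lookup∘tabulate (λ k → sum λ i → lookup v i * M O i k) j ⟩
    sum (λ i → lookup v i * M O i j)
      ≡⟨ sum-single (λ i → lookup v i * M O i j) j (λ i i≢j →
           ≡.trans (≡.cong (lookup v i *_) (off-diagonal i i≢j)) (zeroʳ _)) ⟩
    lookup v j * M O j j
      ≡⟨ ≡.cong (lookup v j *_) diagonal ⟩
    lookup v j * (ℓ j ×ᴿ 1#)
      ∎
    where
    off-diagonal : ∀ i → i ≢ j → M O i j ≡ 0#
    off-diagonal i i≢j with i Fin.≟ j
    ... | yes i≡j = contradiction i≡j i≢j
    ... | no  _   = ≡.refl
    diagonal : M O j j ≡ ℓ j ×ᴿ 1#
    diagonal with j Fin.≟ j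
    ... | yes _   = ≡.refl
    ... | no  j≢j = contradiction ≡.refl j≢j

  *ᴹM-invariant : ∀ {v} → Invariant v → Invariant (v *ᴹ M O)
  *ᴹM-invariant {v} v-inv j h = begin
    lookup (v *ᴹ M O) (j ▷ h)                ≡⟨ lookup-*ᴹM v (j ▷ h) ⟩
    lookup v (j ▷ h) * (ℓ (j ▷ h) ×ᴿ 1#)     ≡⟨ ≡.cong₂ (λ x i → x * (m i ×ᴿ 1#)) (v-inv j h) (orbitOf-▷ O j h) ⟩
    lookup v j * (ℓ j ×ᴿ 1#)                 ≡⟨ lookup-*ᴹM v j ⟨
    lookup (v *ᴹ M O) j                      ∎

  indicator : Fin t → Fin n → Carrier
  indicator i j = 1# when inOrbit? H (α i) j

  indicator-own : ∀ {i j} → InOrbit H (α i) j → indicator i j ≡ 1#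
  indicator-own {i} {j} = when-true (inOrbit? H (α i) j)

  indicator-other : ∀ {i j} → ¬ InOrbit H (α i) j → indicator i j ≡ 0#
  indicator-other {i} {j} = when-false (inOrbit? H (α i) j)

  sum-when : ∀ {k} {P : Pred (Fin k) 0ℓ} (P? : Decidable P) →
    sum (λ j → 1# when P? j) ≡ ∣ tabulate (does ∘ P?) ∣ ×ᴿ 1#
  sum-when {ℕ.zero}  P? = ≡.refl
  sum-when {ℕ.suc k} P? with P? zero
  ... | yes _ = ≡.cong (1# +_) (sum-when (P? ∘ suc))
  ... | no  _ = ≡.trans (+-identityˡ _) (sum-when (P? ∘ suc))

  -- The multiple m_i v_i consists of m_i equal summands, one for each position of the orbit.
  -- Centrality of m_i puts the indicator on the left, where ⟨_,_⟩ expects it.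
  lookup-*ᴹM-α : ∀ {v} → Invariant v → ∀ i →
    lookup (v *ᴹ M O) (α i) ≡ sum λ j → indicator i j * lookup v j
  lookup-*ᴹM-α {v} v-inv i = begin
    lookup (v *ᴹ M O) (α i)                      ≡⟨ lookup-*ᴹM v (α i) ⟩
    lookup v (α i) * (ℓ (α i) ×ᴿ 1#)
      ≡⟨ ≡.cong (λ i → lookup v (α _) * (m i ×ᴿ 1#)) (orbitOf-unique O (inOrbit-refl (α i))) ⟩
    lookup v (α i) * (m i ×ᴿ 1#)                 ≡⟨ ×1-comm (m i) (lookup v (α i)) ⟨
    (m i ×ᴿ 1#) * lookup v (α i)                 ≡⟨ ≡.cong (_* lookup v (α i)) (sum-when (inOrbit? H (α i))) ⟨
    sum (indicator i) * lookup v (α i)           ≡⟨ *-distribʳ-sum (lookup v (α i)) (indicator i) ⟩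
    sum (λ j → indicator i j * lookup v (α i))   ≡⟨ sum-cong-≗ own ⟩
    sum (λ j → indicator i j * lookup v j)       ∎
    where
    own : ∀ j → indicator i j * lookup v (α i) ≡ indicator i j * lookup v j
    own j with inOrbit? H (α i) j
    ... | yes αi∼j = ≡.cong (1# *_) (≡.sym (invariant-inOrbit {v} v-inv αi∼j))
    ... | no  _    = ≡.trans (zeroˡ _) (≡.sym (zeroˡ _))

  sum-indicator : ∀ j → sum (λ i → indicator i j) ≡ 1#
  sum-indicator j = ≡.trans
    (sum-single (λ i → indicator i j) (orbitOf j) λ i i≢ → indicator-other λ αi∼j →
      i≢ (≡.sym (orbitOf-unique O αi∼j)))
    (indicator-own (orbitOf-spec O j))

  -- Every position lies in exactly one orbit, so the indicators add up to 1 there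
  -- (`sum-indicator`); on its orbit, `u` keeps the value it has at the representative.
  ⟨coordinates⟩ : ∀ {u v} → Invariant u → Invariant v →
    ⟨ coordinates u , coordinates (v *ᴹ M O) ⟩ ≡ ⟨ u , v ⟩
  ⟨coordinates⟩ {u} {v} u-inv v-inv = begin
    sum (λ i → lookup (coordinates u) i * lookup (coordinates (v *ᴹ M O)) i)
      ≡⟨ sum-cong-≗ (λ i → begin
           lookup (coordinates u) i * lookup (coordinates (v *ᴹ M O)) i
             ≡⟨ ≡.cong₂ _*_ (lookup-coordinates u i)
                  (≡.trans (lookup-coordinates (v *ᴹ M O) i) (lookup-*ᴹM-α {v} v-inv i)) ⟩
           lookup u (α i) * sum (λ j → indicator i j * lookup v j)
             ≡⟨ *-distribˡ-sum (lookup u (α i)) (λ j → indicator i j * lookup v j) ⟩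
           sum (λ j → lookup u (α i) * (indicator i j * lookup v j))
             ≡⟨ sum-cong-≗ (own i) ⟩
           sum (λ j → indicator i j * (lookup u j * lookup v j))
             ∎) ⟩
    sum (λ i → sum λ j → indicator i j * (lookup u j * lookup v j))
      ≡⟨ ∑-comm (λ i j → indicator i j * (lookup u j * lookup v j)) ⟩
    sum (λ j → sum λ i → indicator i j * (lookup u j * lookup v j))
      ≡⟨ sum-cong-≗ (λ j → begin
           sum (λ i → indicator i j * (lookup u j * lookup v j))
             ≡⟨ *-distribʳ-sum (lookup u j * lookup v j) (λ i → indicator i j) ⟨
           sum (λ i → indicator i j) * (lookup u j * lookup v j)
             ≡⟨ ≡.cong (_* (lookup u j * lookup v j)) (sum-indicator j) ⟩
           1# * (lookup u j * lookup v j)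
             ≡⟨ *-identityˡ _ ⟩
           lookup u j * lookup v j
             ∎) ⟩
    ⟨ u , v ⟩
      ∎
    where
    own : ∀ i j → lookup u (α i) * (indicator i j * lookup v j) ≡ indicator i j * (lookup u j * lookup v j)
    own i j with inOrbit? H (α i) j
    ... | yes αi∼j = ≡.trans (≡.cong₂ _*_ (≡.sym (invariant-inOrbit {u} u-inv αi∼j)) (*-identityˡ _))
                             (≡.sym (*-identityˡ _))
    ... | no  _    = ≡.trans (≡.cong (lookup u (α i) *_) (zeroˡ _)) (≡.trans (zeroʳ _) (≡.sym (zeroˡ _)))

  -- The transpose of `coordinates`. Each `w_i` is placed at the representative alone; placed on the
  -- whole orbit, it would be fixed by θ and `M` would leave a factor m_i to be inverted.
  spread : V t → V n
  spread w = tabulate λ j → sum λ i → lookup w i when (α i Fin.≟ j)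

  ⟨-,spread⟩ : ∀ v w → ⟨ v , spread w ⟩ ≡ ⟨ coordinates v , w ⟩
  ⟨-,spread⟩ v w = begin
    sum (λ j → lookup v j * lookup (spread w) j)
      ≡⟨ sum-cong-≗ (λ j → ≡.trans
           (≡.cong (lookup v j *_) (Vec.lookup∘tabulate (λ j → sum λ i → lookup w i when (α i Fin.≟ j)) j))
           (*-distribˡ-sum (lookup v j) (λ i → lookup w i when (α i Fin.≟ j)))) ⟩
    sum (λ j → sum λ i → lookup v j * (lookup w i when (α i Fin.≟ j)))
      ≡⟨ ∑-comm (λ j i → lookup v j * (lookup w i when (α i Fin.≟ j))) ⟩
    sum (λ i → sum λ j → lookup v j * (lookup w i when (α i Fin.≟ j)))
      ≡⟨ sum-cong-≗ (λ i → begin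
           sum (λ j → lookup v j * (lookup w i when (α i Fin.≟ j)))
             ≡⟨ sum-single (λ j → lookup v j * (lookup w i when (α i Fin.≟ j))) (α i) (λ j j≢αi → ≡.trans
                  (≡.cong (lookup v j *_) (when-false (α i Fin.≟ j) (j≢αi ∘ ≡.sym))) (zeroʳ _)) ⟩
           lookup v (α i) * (lookup w i when (α i Fin.≟ α i))
             ≡⟨ ≡.cong₂ _*_ (≡.sym (lookup-coordinates v i)) (when-true (α i Fin.≟ α i) ≡.refl) ⟩
           lookup (coordinates v) i * lookup w i
             ∎) ⟩
    ⟨ coordinates v , w ⟩
      ∎

  -- The i-th coordinate of y M_H is the inner product of y with the indicator of
  -- the i-th orbit. For y = θ (spread w), adjointness of θ moves θ onto that
  -- indicator, which it fixes; this replaces the orbit-stabiliser theorem.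
  coordinates-θ-spread : ∀ w → coordinates (θᴴ (spread w) *ᴹ M O) ≡ w
  coordinates-θ-spread w = lookup-injective λ i → begin
    lookup (coordinates (θᴴ (spread w) *ᴹ M O)) i
      ≡⟨ lookup-coordinates (θᴴ (spread w) *ᴹ M O) i ⟩
    lookup (θᴴ (spread w) *ᴹ M O) (α i)
      ≡⟨ lookup-*ᴹM-α {θᴴ (spread w)} (θ-invariant (spread w)) i ⟩
    sum (λ j → indicator i j * lookup (θᴴ (spread w)) j)
      ≡⟨ sum-cong-≗ (λ j → ≡.cong (_* lookup (θᴴ (spread w)) j) (lookup-𝟙 i j)) ⟨
    ⟨ 𝟙 i , θᴴ (spread w) ⟩
      ≡⟨ θ-adjoint (𝟙 i) (spread w) ⟩
    ⟨ θᴴ (𝟙 i) , spread w ⟩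
      ≡⟨ ≡.cong (λ v → ⟨ v , spread w ⟩) (θ-fixes {𝟙 i} (𝟙-invariant i)) ⟩
    ⟨ 𝟙 i , spread w ⟩
      ≡⟨ ⟨-,spread⟩ (𝟙 i) w ⟩
    sum (λ i′ → lookup (coordinates (𝟙 i)) i′ * lookup w i′)
      ≡⟨ sum-single (λ i′ → lookup (coordinates (𝟙 i)) i′ * lookup w i′) i (λ i′ i′≢i → ≡.trans
           (≡.cong (_* lookup w i′) (≡.trans (lookup-𝟙-α i i′) (indicator-other λ αi∼αi′ →
             i′≢i (≡.sym (disjoint αi∼αi′)))))
           (zeroˡ _)) ⟩
    lookup (coordinates (𝟙 i)) i * lookup w i
      ≡⟨ ≡.cong (_* lookup w i) (≡.trans (lookup-𝟙-α i i) (indicator-own (inOrbit-refl (α i)))) ⟩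
    1# * lookup w i
      ≡⟨ *-identityˡ _ ⟩
    lookup w i
      ∎
    where
    𝟙 : Fin t → V n
    𝟙 i = tabulate (indicator i)
    lookup-𝟙 : ∀ i j → lookup (𝟙 i) j ≡ indicator i j
    lookup-𝟙 i = Vec.lookup∘tabulate (indicator i)
    lookup-𝟙-α : ∀ i i′ → lookup (coordinates (𝟙 i)) i′ ≡ indicator i (α i′)
    lookup-𝟙-α i i′ = ≡.trans (lookup-coordinates (𝟙 i) i′) (lookup-𝟙 i (α i′))
    indicator-▷ : ∀ i j h → indicator i (j ▷ h) ≡ indicator i j
    indicator-▷ i j h with inOrbit? H (α i) j
    ... | yes αi∼j = indicator-own (inOrbit-trans αi∼j (inOrbit-▷ j h))
    ... | no  αi≁j = indicator-other λ αi∼jh →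
      αi≁j (inOrbit-trans αi∼jh (inOrbit-sym (inOrbit-▷ j h)))
    𝟙-invariant : ∀ i → Invariant (𝟙 i)
    𝟙-invariant i j h = ≡.trans (lookup-𝟙 i (j ▷ h)) (≡.trans (indicator-▷ i j h) (≡.sym (lookup-𝟙 i j)))

  coordinates-+ : ∀ u v → coordinates u V.+ᴹ coordinates v ≡ coordinates (u V.+ᴹ v)
  coordinates-+ u v = lookup-injective λ i → begin
    lookup (coordinates u V.+ᴹ coordinates v) i
      ≡⟨ Vec.lookup-zipWith _+_ i (coordinates u) (coordinates v) ⟩
    lookup (coordinates u) i + lookup (coordinates v) i
      ≡⟨ ≡.cong₂ _+_ (lookup-coordinates u i) (lookup-coordinates v i) ⟩
    lookup u (α i) + lookup v (α i)
      ≡⟨ Vec.lookup-zipWith _+_ (α i) u v ⟨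
    lookup (u V.+ᴹ v) (α i)
      ≡⟨ lookup-coordinates (u V.+ᴹ v) i ⟨
    lookup (coordinates (u V.+ᴹ v)) i
      ∎

  coordinates-* : ∀ r v → r V.*ₗ coordinates v ≡ coordinates (r V.*ₗ v)
  coordinates-* r v = lookup-injective λ i → begin
    lookup (r V.*ₗ coordinates v) i      ≡⟨ Vec.lookup-map i (r *_) (coordinates v) ⟩
    r * lookup (coordinates v) i         ≡⟨ ≡.cong (r *_) (lookup-coordinates v i) ⟩
    r * lookup v (α i)                   ≡⟨ Vec.lookup-map (α i) (r *_) v ⟨
    lookup (r V.*ₗ v) (α i)              ≡⟨ lookup-coordinates (r V.*ₗ v) i ⟨
    lookup (coordinates (r V.*ₗ v)) i    ∎

  module _ {G : PermutationGroup n} (H≤G : H ≤ᴳ G) (C : LeftGCode G) where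
    open LeftGCode C using (0∈; +-closed; *ₗ-closed; ·-closed)
    open Members R

    θ-closed : ∀ {v} → member (subset C) v → member (subset C) (θᴴ v)
    θ-closed {v} v∈C = *ₗ-closed 1/∣H∣ (sumⱽ-closed (λ h → v · perm H h) ·H-closed)
      where
      sumⱽ-closed : ∀ {k} (f : Fin k → V n) → (∀ i → member (subset C) (f i)) → member (subset C) (sumⱽ f)
      sumⱽ-closed {ℕ.zero}  f f∈C = 0∈
      sumⱽ-closed {ℕ.suc k} f f∈C = +-closed (f∈C zero) (sumⱽ-closed (f ∘ suc) (f∈C ∘ suc))
      ·H-closed : ∀ h → member (subset C) (v · perm H h)
      ·H-closed h with (g , g≈h) ← H≤G h =
        ≡.subst (member (subset C)) (Vec.tabulate-cong λ j → ≡.cong (lookup v) (same-inverse j)) (·-closed g v∈C)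
        where
        -- `H ≤ᴳ G` compares the permutations in the forward direction, whereas `_·_` reads their
        -- inverses.
        same-inverse : ∀ j → perm G g Perm.⟨$⟩ˡ j ≡ j ◁ h
        same-inverse j = ≡.trans
          (≡.cong (perm G g Perm.⟨$⟩ˡ_) (≡.trans (≡.sym (◁-▷ j h)) (≡.sym (g≈h (j ◁ h)))))
          (Perm.inverseˡ (perm G g))

    projectedCode : SubsetV t
    projectedCode = record
      { member  = λ w → ∃ λ u → member (Cθ C H ∣H∣-unit) u × coordinates u ≡ w
      ; member? = λ w → ∃ⱽ? λ u → member? (Cθ C H ∣H∣-unit) u ×-dec (coordinates u ≟ⱽ w)
      }

    projectedCode-isLeftSubmodule : IsLeftSubmodule projectedCode
    projectedCode-isLeftSubmodule = record
      -- Zero is reached as the multiple by 0 of the projection of a codeword.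
      { 0∈        = ≡.subst (member projectedCode) 0*w≡0 (scale 0# project-0∈)
      ; +-closed  = λ { (_ , (u , u∈C , ≡.refl) , ≡.refl) (_ , (v , v∈C , ≡.refl) , ≡.refl) →
          _ , (_ , +-closed u∈C v∈C , ≡.refl) ,
          ≡.trans (≡.cong coordinates (≡.sym (θ-+ u v))) (≡.sym (coordinates-+ (θᴴ u) (θᴴ v))) }
      ; *ₗ-closed = scale
      }
      where
      scale : ∀ r {w} → member projectedCode w → member projectedCode (r V.*ₗ w)
      scale r (_ , (v , v∈C , ≡.refl) , ≡.refl) = _ , (_ , *ₗ-closed r v∈C , ≡.refl) ,
        ≡.trans (≡.cong coordinates (≡.sym (θ-* r v))) (≡.sym (coordinates-* r (θᴴ v)))
      project-0∈ : member projectedCode (coordinates (θᴴ V.0ᴹ))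
      project-0∈ = _ , (_ , 0∈ , ≡.refl) , ≡.refl
      0*w≡0 : ∀ {w : V t} → 0# V.*ₗ w ≡ V.0ᴹ
      0*w≡0 {w} = ≡.trans (Vec.map-cong zeroˡ w) (Vec.map-const w 0#)

    private
      Cθ-invariant : ∀ {u} → member (Cθ C H ∣H∣-unit) u → Invariant u
      Cθ-invariant (v , _ , ≡.refl) = θ-invariant v

      dual : SubsetV n
      dual = image (_*ᴹ M O) (image (θ H ∣H∣-unit) (subset C ⊥ʳ))

      dual-invariant : ∀ {x} → member dual x → Invariant x
      dual-invariant (_ , (y , _ , ≡.refl) , ≡.refl) = *ᴹM-invariant {θᴴ y} (θ-invariant y)

    members-projectedCode : map coordinates (members (Cθ C H ∣H∣-unit)) ↭ members projectedCode
    members-projectedCode = members-↭ (Cθ C H ∣H∣-unit) projectedCode coordinates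
      (λ {u} u∈ → u , u∈ , ≡.refl)
      (λ u∈ v∈ → coordinates-injective (Cθ-invariant u∈) (Cθ-invariant v∈))
      (λ (u , u∈ , eq) → u , u∈ , eq)

    members-dual : map coordinates (members dual) ↭ members (projectedCode ⊥ʳ)
    members-dual = members-↭ dual (projectedCode ⊥ʳ) coordinates coordinates-dual
      (λ x∈ y∈ → coordinates-injective (dual-invariant x∈) (dual-invariant y∈))
      (λ {w} w∈ → θᴴ (spread w) *ᴹ M O ,
        -- The preimage in the dual of `C` is θ (spread w), which idempotence makes its own
        -- projection. The vector `spread w` itself may fail to lie there: its product with `v` sees
        -- the coordinates of `v`, not those of θ v.
        (θᴴ (spread w) , (θᴴ (spread w) , θ-spread∈C⊥ {w} w∈ , θ-idempotent (spread w)) , ≡.refl) ,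
        coordinates-θ-spread w)
      where
      coordinates-dual : ∀ {x} → member dual x → member (projectedCode ⊥ʳ) (coordinates x)
      coordinates-dual (_ , (y , y∈C⊥ , ≡.refl) , ≡.refl) _ (_ , (v , v∈C , ≡.refl) , ≡.refl) = begin
        ⟨ coordinates (θᴴ v) , coordinates (θᴴ y *ᴹ M O) ⟩
          ≡⟨ ⟨coordinates⟩ {θᴴ v} {θᴴ y} (θ-invariant v) (θ-invariant y) ⟩
        ⟨ θᴴ v , θᴴ y ⟩          ≡⟨ θ-adjoint (θᴴ v) y ⟩
        ⟨ θᴴ (θᴴ v) , y ⟩        ≡⟨ ≡.cong (λ u → ⟨ u , y ⟩) (θ-idempotent v) ⟩
        ⟨ θᴴ v , y ⟩             ≡⟨ y∈C⊥ (θᴴ v) (θ-closed v∈C) ⟩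
        0#                       ∎
      θ-spread∈C⊥ : ∀ {w} → member (projectedCode ⊥ʳ) w → member (subset C ⊥ʳ) (θᴴ (spread w))
      θ-spread∈C⊥ {w} w∈ v v∈C = begin
        ⟨ v , θᴴ (spread w) ⟩            ≡⟨ θ-adjoint v (spread w) ⟩
        ⟨ θᴴ v , spread w ⟩              ≡⟨ ⟨-,spread⟩ (θᴴ v) w ⟩
        ⟨ coordinates (θᴴ v) , w ⟩       ≡⟨ w∈ _ (_ , (v , v∈C , ≡.refl) , ≡.refl) ⟩
        0#                               ∎

-- From the code in R^t back to Jacobi polynomials

1/-cong : ∀ {k l} .{{_ : ℕ.NonZero k}} .{{_ : ℕ.NonZero l}} → k ≡ l → (ℤ.+ 1) ℚ./ k ≡ (ℤ.+ 1) ℚ./ l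
1/-cong ≡.refl = ≡.refl

module JacobiMacWilliams (R : FiniteRing) (χ : Character R) (P : CommutativeSemiring 0ℓ 0ℓ)
  (κ : ℂ → CommutativeSemiring.Carrier P)
  (κ-homomorphism : IsSemiringHomomorphism
    (CommutativeSemiring.rawSemiring ℂR.commutativeSemiring) (CommutativeSemiring.rawSemiring P) κ)
  (_~_ : Rel (CommutativeSemiring.Carrier P) 0ℓ) where
  private module P = CommutativeSemiring P

  open FiniteRing R
  open Code R hiding (transform; sum)
  open MacWilliams R χ P κ κ-homomorphism using (weight; transform; macWilliams)
  open CompleteJacobi R P _~_ using (rawSemiring; choose; CJ-product)
  open ListSum P.+-commutativeMonoid using (foldMap; foldMap-cong; foldMap-map; foldMap-↭)
  open CommutativeMonoidSum P.*-commutativeMonoid using () renaming (sum to product; sum-cong-≋ to product-cong)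
  open SetoidReasoning P.setoid

  choose-transform : ∀ {t} (T : Subset t) x y i a →
    choose T (transform x) (transform y) i a ≡ transform (choose T x y i) a
  choose-transform T x y i a with i ∈? T
  ... | yes _ = ≡.refl
  ... | no  _ = ≡.refl

  module _ {n} {G H : PermutationGroup n} (H≤G : H ≤ᴳ G) (∣H∣-unit : OrderInvertible H)
           (O : Orbits H) (T : Subset (Orbits.t O)) (C : LeftGCode G) where
    open Coordinates R O ∣H∣-unit

    private
      D = projectedCode H≤G C
      dual = image (_*ᴹ M O) (image (θ H ∣H∣-unit) (subset C ⊥ʳ))

    CJ-weight : ∀ X x y → CJ O rawSemiring X T x y P.≈
      foldMap (weight (choose T x y)) (map coordinates (members X))
    CJ-weight X x y = begin
      CJ O rawSemiring X T x y
        ≈⟨ CJ-product O T x y X ⟩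
      foldMap (λ u → product λ i → choose T x y i (coordinate O u i)) (members X)
        ≈⟨ foldMap-cong (members X) (λ {u} _ → product-cong λ i →
             P.reflexive (≡.cong (choose T x y i) (≡.sym (lookup-coordinates u i)))) ⟩
      foldMap (λ u → weight (choose T x y) (coordinates u)) (members X)
        ≡⟨ foldMap-map (weight (choose T x y)) coordinates (members X) ⟨
      foldMap (weight (choose T x y)) (map coordinates (members X))
        ∎

    size-projectedCode : size D ≡ size (Cθ C H ∣H∣-unit)
    size-projectedCode = ≡.trans (≡.sym (↭.↭-length (members-projectedCode H≤G C)))
      (List.length-map coordinates (members (Cθ C H ∣H∣-unit)))

    1/∣D∣≡1/∣Cθ∣ : .{{_ : ℕ.NonZero (size D)}} → ofℚ ((ℤ.+ 1) ℚ./ size D) ≡ 1/∣Cθ∣ C H ∣H∣-unit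
    1/∣D∣≡1/∣Cθ∣ {{D-nonZero}} = ≡.cong ofℚ (1/-cong {{D-nonZero}}
      {{size-nonZero (Cθ C H ∣H∣-unit) (_ , LeftGCode.0∈ C , ≡.refl)}} size-projectedCode)

    CJ-macWilliams : IsGenerating R χ → ∀ x y →
      CJ O rawSemiring dual T x y P.≈
      κ (1/∣Cθ∣ C H ∣H∣-unit) P.* CJ O rawSemiring (Cθ C H ∣H∣-unit) T (transform x) (transform y)
    CJ-macWilliams χ-generating x y = begin
      CJ O rawSemiring dual T x y
        ≈⟨ CJ-weight dual x y ⟩
      foldMap (weight z) (map coordinates (members dual))
        ≈⟨ foldMap-↭ (weight z) (members-dual H≤G C) ⟩
      foldMap (weight z) (members (D ⊥ʳ))
        ≈⟨ macWilliams χ-generating D D-submodule z {{D-nonZero}} ⟩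
      κ (ofℚ (((ℤ.+ 1) ℚ./ size D) {{D-nonZero}})) P.* foldMap (weight λ i → transform (z i)) (members D)
        ≡⟨ ≡.cong (λ c → κ c P.* foldMap (weight λ i → transform (z i)) (members D)) (1/∣D∣≡1/∣Cθ∣ {{D-nonZero}}) ⟩
      κ (1/∣Cθ∣ C H ∣H∣-unit) P.* foldMap (weight λ i → transform (z i)) (members D)
        ≈⟨ P.*-congˡ (begin
             foldMap (weight λ i → transform (z i)) (members D)
               ≈⟨ foldMap-↭ (weight λ i → transform (z i)) (members-projectedCode H≤G C) ⟨
             foldMap (weight λ i → transform (z i)) (map coordinates (members (Cθ C H ∣H∣-unit)))
               ≈⟨ foldMap-cong (map coordinates (members (Cθ C H ∣H∣-unit))) (λ {u} _ →
                    product-cong λ i → P.reflexive (choose-transform T x y i (lookup u i))) ⟨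
             foldMap (weight (choose T (transform x) (transform y))) (map coordinates (members (Cθ C H ∣H∣-unit)))
               ≈⟨ CJ-weight (Cθ C H ∣H∣-unit) (transform x) (transform y) ⟨
             CJ O rawSemiring (Cθ C H ∣H∣-unit) T (transform x) (transform y)
               ∎) ⟩
      κ (1/∣Cθ∣ C H ∣H∣-unit) P.* CJ O rawSemiring (Cθ C H ∣H∣-unit) T (transform x) (transform y)
        ∎
      where
      z = choose T x y
      D-submodule = projectedCode-isLeftSubmodule H≤G C
      D-nonZero = size-nonZero D (IsLeftSubmodule.0∈ D-submodule)

theorem6p1 : (R : FiniteRing) → IsFrobenius R →
    (χ : Character R) → IsGenerating R χ →
    let open Code R
        open RawRing ℂ[x,y] using (rawSemiring) renaming (_≈_ to infix 4 _≈_)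
        open RawRing ℂ[x,y] using () renaming (_*_ to infixl 7 _*_)
    in
    (n : ℕ) (G H : PermutationGroup n) → H ≤ᴳ G →
    (∣H∣-unit : OrderInvertible H) (O : Orbits H) (T : Subset (Orbits.t O)) (C : LeftGCode G) →
    CJ O rawSemiring (image (_*ᴹ M O) (image (θ H ∣H∣-unit) (subset C ⊥ʳ))) T X Y
      ≈ const (1/∣Cθ∣ C H ∣H∣-unit) * CJ O rawSemiring (Cθ C H ∣H∣-unit) T (transform χ X) (transform χ Y)
theorem6p1 R _ χ χ-generating n G H H≤G ∣H∣-unit O T C =
  -- The identity is proved for the finer relation `≋`, while `_≈ₚ_` is supplied as the equality
  -- carried by the raw semiring in `CJ`, so that both sides are those of the statement.
  ≋⇒≈ₚ (JacobiMacWilliams.CJ-macWilliams R χ commutativeSemiring const const-isSemiringHomomorphism _≈ₚ_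
    H≤G ∣H∣-unit O T C χ-generating (Code.X R) (Code.Y R))
  where open PolynomialSemiring (FiniteRing.card R ℕ.+ FiniteRing.card R)
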